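{- For every integer $n\ge 0$, the Hankel determinant $H_{n}\big(B_{2k}(\tfrac{1+x}{2})\big)=\det_{0\le i,j\le n}\big(B_{2(i+j)}(\tfrac{1+x}{2})\big)$ is a polynomial in $x$ of degree exactly $n(n+1)$, and its leading coefficient is \[ \big[x^{n(n+1)}\big]H_{n}\left(B_{2k}\left(\frac{1+x}{2}\right)\right)=(-1)^{\binom{n+1}{2}}\prod_{j=1}^{n}\frac{(j!)^{6}}{(2j)!\,(2j+1)!}. \]
   Context: The Bernoulli polynomials $B_k(x)$ are defined by $\frac{te^{xt}}{e^t-1}=\sum_{k\ge0}B_k(x)\frac{t^k}{k!}$. For a sequence $(a_k)_{k\ge0}$, its $n$-th Hankel determinant is $H_n(a_k):=\det_{0\le i,j\le n}(a_{i+j})$. The notation $[x^m]P(x)$ denotes the coefficient of $x^m$ in the polynomial $P(x)$. -}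

module Defs where

open import Data.Nat as ℕ using (ℕ; zero; suc; _!)
open import Data.Nat.Properties using (_!*_!≢0)
open import Data.Nat.Combinatorics using (_C_)
open import Data.Integer as ℤ using (ℤ; +_)
open import Data.Rational as ℚ using (ℚ; 0ℚ; 1ℚ; ½; -_)
open import Data.Fin as Fin using (Fin; toℕ; punchIn)
open import Data.List using (List; []; _∷_)

-- Polynomials over ℚ: coefficient lists, lowest degree first.
-- (Trailing zeros are allowed; all statements go through `coeff`.)
Poly : Set
Poly = List ℚ

coeff : Poly → ℕ → ℚ
coeff []      _       = 0ℚ
coeff (a ∷ p) zero    = a
coeff (a ∷ p) (suc m) = coeff p m

infixl 6 _+ₚ_
infixl 7 _*ₚ_ _·ₚ_

_+ₚ_ : Poly → Poly → Poly
[]      +ₚ q       = q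
(a ∷ p) +ₚ []      = a ∷ p
(a ∷ p) +ₚ (b ∷ q) = (a ℚ.+ b) ∷ (p +ₚ q)

_·ₚ_ : ℚ → Poly → Poly
c ·ₚ []      = []
c ·ₚ (a ∷ p) = (c ℚ.* a) ∷ (c ·ₚ p)

_*ₚ_ : Poly → Poly → Poly
[]      *ₚ q = []
(a ∷ p) *ₚ q = (a ·ₚ q) +ₚ (0ℚ ∷ (p *ₚ q))

constₚ : ℚ → Poly
constₚ c = c ∷ []

_^ₚ_ : Poly → ℕ → Poly
p ^ₚ zero  = constₚ 1ℚ
p ^ₚ suc k = p *ₚ (p ^ₚ k)

sumℚ : (n : ℕ) → (ℕ → ℚ) → ℚ
sumℚ zero    f = 0ℚ
sumℚ (suc n) f = sumℚ n f ℚ.+ f n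

sumₚ : (n : ℕ) → (ℕ → Poly) → Poly
sumₚ zero    f = []
sumₚ (suc n) f = sumₚ n f +ₚ f n

sumFinₚ : (n : ℕ) → (Fin n → Poly) → Poly
sumFinₚ zero    f = []
sumFinₚ (suc n) f = f Fin.zero +ₚ sumFinₚ n (λ j → f (Fin.suc j))

fromℕℚ : ℕ → ℚ
fromℕℚ n = + n ℚ./ 1

-- Bernoulli numbers B_m = B_m(0) (so B_1 = -1/2), via the standard recursion
-- B_0 = 1,  B_m = -(1/(m+1)) Σ_{j<m} C(m+1,j) B_j,
-- which is equivalent to t/(e^t - 1) = Σ B_m t^m / m!.
bernoulliNum : ℕ → ℚ
bernoulliNum m = go m m
  where
  -- go fuel m : fuel ≥ m ensures structural recursion
  go : ℕ → ℕ → ℚ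
  go _        zero    = 1ℚ
  go zero     (suc m) = 0ℚ  -- unreachable (fuel always ≥ index)
  go (suc f)  (suc m) =
    - ((+ 1 ℚ./ suc (suc m)) ℚ.*
       sumℚ (suc m) (λ j → fromℕℚ (suc (suc m) C j) ℚ.* go f j))

-- Bernoulli polynomial evaluated at a polynomial argument q(x):
-- B_k(q) = Σ_{j=0}^{k} C(k,j) B_j q^{k-j}   (from te^{xt}/(e^t-1) = e^{xt}·t/(e^t-1)).
bernoulliAt : ℕ → Poly → Poly
bernoulliAt k q =
  sumₚ (suc k) (λ j → (fromℕℚ (k C j) ℚ.* bernoulliNum j) ·ₚ (q ^ₚ (k ℕ.∸ j)))

halfOnePlusX : Poly
halfOnePlusX = ½ ∷ ½ ∷ []

signℚ : ℕ → ℚ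
signℚ zero    = 1ℚ
signℚ (suc k) = - signℚ k

det : (n : ℕ) → (Fin n → Fin n → Poly) → Poly
det zero    M = constₚ 1ℚ
det (suc n) M =
  sumFinₚ (suc n) (λ j →
    signℚ (toℕ j) ·ₚ (M Fin.zero j *ₚ det n (λ r c → M (Fin.suc r) (punchIn j c))))

hankel : (n : ℕ) → (ℕ → Poly) → Poly
hankel n a = det (suc n) (λ i j → a (toℕ i ℕ.+ toℕ j))

bernoulliSeq : ℕ → Poly
bernoulliSeq k = bernoulliAt (2 ℕ.* k) halfOnePlusX

prodFactor : ℕ → ℚ
prodFactor j = (+ ((j !) ℕ.^ 6) ℚ./ ((2 ℕ.* j) ! ℕ.* (suc (2 ℕ.* j)) !))
  {{(2 ℕ.* j) !* (suc (2 ℕ.* j)) !≢0}}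

prodℚ : ℕ → ℚ
prodℚ zero    = 1ℚ
prodℚ (suc n) = prodℚ n ℚ.* prodFactor (suc n)

leadingValue : ℕ → ℚ
leadingValue n = signℚ ((suc n) C 2) ℚ.* prodℚ n

{-# OPTIONS --safe #-}
-- Let L be the umbral functional L[zᵏ] = Bₖ and y = (1 + x)/2, so that
-- B₂ₖ(y) = L[((y + z)²)ᵏ].  A Hankel determinant does not change when the
-- variable is translated, so (y + z)² may be replaced by
-- (y + z)² - y² = z(z + 2y) = z(z + 1 + x).  The k-th moment is then
-- L[zᵏ(z + 1 + x)ᵏ], of degree at most k in x with xᵏ-coefficient Bₖ; hence the
-- determinant has degree at most n(n+1) and leading coefficient det(B_{i+j}).
--
-- For det(B_{i+j}) take the bases f_i = (z+1)...(z+i) and g_j = z(z-1)...(z-j+1).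
-- With p = (z+i)(z+i-1)...(z-j) one has p(z+1) - p(z) = (i+j+1) f_i g_j, and
-- L[p(z+1) - p(z)] = p'(0), so L[f_i g_j] = (-1)^j i! j! / (i+j+1).  Up to row and
-- column factors this is the Hilbert matrix, whose determinant is computed by
-- clearing the first column: the Schur complement of 1/(b+1+i+j) is a Hilbert
-- matrix with b + 2 in place of b, again up to row and column factors.
module Submission where

open import Algebra.Bundles using (CommutativeRing)
open import Data.Fin using (Fin; zero; suc; toℕ; punchIn)
open import Data.Integer as ℤ using (+_)
import Data.Integer.Properties as ℤₚ
open import Data.Nat as ℕ using (ℕ; zero; suc; _!; _∸_; NonZero)
open import Data.Nat.Combinatorics
  using (_C_; nCk+nC[k+1]≡[n+1]C[k+1]; k>n⇒nCk≡0; nCk≡nC[n∸k]; nC1≡n; nCn≡1)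
import Data.Nat.Properties as ℕₚ
open import Data.Nat.Solver using () renaming (module +-*-Solver to ℕ-Solver)
open import Data.Product using (_,_; _×_; ∃)
open import Data.Rational as ℚ using (ℚ; 0ℚ; 1ℚ)
import Data.Rational.Properties as ℚₚ
open import Data.Rational.Solver using () renaming (module +-*-Solver to ℚ-Solver)
import Data.Rational.Unnormalised as ℚᵘ
import Data.Rational.Unnormalised.Properties as ℚᵘₚ
open import Data.Sum using (_⊎_; inj₁; inj₂)
open import Function using (_∘_)
open import Level using (0ℓ; _⊔_)
open import Relation.Binary.Bundles using (Setoid)
open import Relation.Binary.PropositionalEquality as ≡ using (_≡_; _≢_; _≗_)

open ℕ-Solver using ()
  renaming (solve to ℕ-solve; _:=_ to _⊜_; _:+_ to _⊕_; _:*_ to _⊗_; con to ℕ-con)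

-- Determinants

-- The translation is what makes the true degree visible. The untouched entries have degree 2(i+j)
-- in x with top coefficients 4^(-(i+j)). These form a matrix of rank one, so for n ≥ 1 comparing
-- top coefficients shows only that the degree is below 2n(n+1). Once y² is removed, the degree
-- bound is halved and the top coefficients are Bernoulli numbers, whose Hankel determinant is not
-- zero. The translation happens over ℚ[x], the evaluation over ℚ, so both rest on determinants and
-- functionals over an arbitrary commutative ring; the reciprocals that the Hilbert matrix needs are
-- supplied as a sequence. Polynomials in z are never formed: they act on sequences of moments,
-- where multiplication by z is `shift`.

module Determinant {c ℓ} (R : CommutativeRing c ℓ) where

  open CommutativeRing R hiding (zero)
  open import Data.Vec.Functional using (Vector; _∷_; tail)
  import Algebra.Properties.Semiring.Sum semiring as Sum
  import Algebra.Properties.CommutativeMonoid.Sum *-commutativeMonoid as Product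
  open import Algebra.Properties.Ring ring
    using (-‿distribˡ-*; -‿distribʳ-*; -‿involutive; +-inverseˡ-unique)
  open import Algebra.Solver.Ring.NaturalCoefficients.Default commutativeSemiring
    using (solve; _:=_; _:+_; _:*_)
  open import Relation.Binary.Reasoning.Setoid setoid

  Matrix : ℕ → ℕ → Set c
  Matrix m n = Fin m → Fin n → Carrier

  sgn : ℕ → Carrier
  sgn zero    = 1#
  sgn (suc k) = - sgn k

  minor : ∀ {m n} → Fin (suc n) → Matrix m (suc n) → Matrix m n
  minor j N r c = N r (punchIn j c)

  -- Sums and determinants are opaque so that unification can recover the
  -- summand and the matrix from them.
  opaque
    ∑ : ∀ {n} → Vector Carrier n → Carrier
    ∑ = Sum.sum

    ∑-zero : ∀ (f : Vector Carrier 0) → ∑ f ≈ 0#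
    ∑-zero f = refl

    ∑-suc : ∀ {n} (f : Vector Carrier (suc n)) → ∑ f ≈ f zero + ∑ (λ i → f (suc i))
    ∑-suc f = refl

    ∑-cong : ∀ {n} {f g : Vector Carrier n} → (∀ i → f i ≈ g i) → ∑ f ≈ ∑ g
    ∑-cong = Sum.sum-cong-≋

    ∑-0 : ∀ n → ∑ {n} (λ _ → 0#) ≈ 0#
    ∑-0 = Sum.sum-replicate-zero

    ∑-+ : ∀ {n} (f g : Vector Carrier n) → ∑ (λ i → f i + g i) ≈ ∑ f + ∑ g
    ∑-+ = Sum.∑-distrib-+

    ∑-comm : ∀ {m n} (f : Matrix m n) → ∑ (λ i → ∑ (λ j → f i j)) ≈ ∑ (λ j → ∑ (λ i → f i j))
    ∑-comm = Sum.∑-comm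

    *-∑ : ∀ {n} x (f : Vector Carrier n) → x * ∑ f ≈ ∑ (λ i → x * f i)
    *-∑ = Sum.*-distribˡ-sum

    ∑-last : ∀ n (f : ℕ → Carrier) → ∑ {suc n} (f ∘ toℕ) ≈ ∑ {n} (f ∘ toℕ) + f n
    ∑-last zero    f = +-comm _ _
    ∑-last (suc n) f = trans (+-congˡ (∑-last n (f ∘ suc))) (sym (+-assoc _ _ _))

    ∏ : ∀ {n} → Vector Carrier n → Carrier
    ∏ = Product.sum

    ∏-zero : ∀ (f : Vector Carrier 0) → ∏ f ≈ 1#
    ∏-zero f = refl

    ∏-suc : ∀ {n} (f : Vector Carrier (suc n)) → ∏ f ≈ f zero * ∏ (λ i → f (suc i))
    ∏-suc f = refl

    ∏-* : ∀ {n} (f g : Vector Carrier n) → ∏ (λ i → f i * g i) ≈ ∏ f * ∏ g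
    ∏-* = Product.∑-distrib-+

    ∏-last : ∀ n (f : ℕ → Carrier) → ∏ {suc n} (f ∘ toℕ) ≈ ∏ {n} (f ∘ toℕ) * f n
    ∏-last zero    f = *-comm _ _
    ∏-last (suc n) f = trans (*-congˡ (∏-last n (f ∘ suc))) (sym (*-assoc _ _ _))

  -‿∑ : ∀ {n} (f : Vector Carrier n) → - ∑ f ≈ ∑ (λ i → - f i)
  -‿∑ {n} f = sym (+-inverseˡ-unique _ _ (begin
    ∑ (λ i → - f i) + ∑ f   ≈⟨ ∑-+ (λ i → - f i) f ⟨
    ∑ (λ i → - f i + f i)   ≈⟨ ∑-cong (λ i → -‿inverseˡ (f i)) ⟩
    ∑ {n} (λ _ → 0#)        ≈⟨ ∑-0 n ⟩
    0# ∎))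

  opaque
    det : ∀ n → Matrix n n → Carrier
    det zero    M = 1#
    det (suc n) M = ∑ λ j → sgn (toℕ j) * (M zero j * det n (minor j (tail M)))

    det-zero : ∀ M → det zero M ≈ 1#
    det-zero M = refl

    det-suc : ∀ n M → det (suc n) M ≈ ∑ λ j → sgn (toℕ j) * (M zero j * det n (minor j (tail M)))
    det-suc n M = refl

  det-cong : ∀ n {M N : Matrix n n} → (∀ i j → M i j ≈ N i j) → det n M ≈ det n N
  det-cong zero    M≈N = trans (det-zero _) (sym (det-zero _))
  det-cong (suc n) M≈N = trans (det-suc n _) (trans
    (∑-cong λ j → *-congˡ (*-cong (M≈N zero j) (det-cong n λ r c → M≈N (suc r) (punchIn j c))))
    (sym (det-suc n _)))

  det-head-tail : ∀ n {M : Matrix (suc n) (suc n)} {u N} →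
    (∀ j → M zero j ≈ u j) → (∀ i j → M (suc i) j ≈ N i j) →
    det (suc n) M ≈ det (suc n) (u ∷ N)
  det-head-tail n h t = det-cong (suc n) λ { zero → h ; (suc i) → t i }

  det-∷ : ∀ n u (N : Matrix n (suc n)) →
    det (suc n) (u ∷ N) ≈ ∑ λ j → sgn (toℕ j) * (u j * det n (minor j N))
  det-∷ n u N = det-suc n (u ∷ N)

  -- The shape of a Laplace expansion along the first two rows: j and l = `punchIn j k` are the
  -- columns taken there, and the last argument of `F` enumerates the remaining columns in
  -- increasing order. Exchanging j and l keeps that enumeration and reverses the sign.
  pairs : ∀ n → (Fin (2 ℕ.+ n) → Fin (2 ℕ.+ n) → (Fin n → Fin (2 ℕ.+ n)) → Carrier) → Carrier
  pairs n F = ∑ λ j → sgn (toℕ j) * ∑ λ k → sgn (toℕ k) * F j (punchIn j k) (punchIn j ∘ punchIn k)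

  -- Keeps column zero among the remaining columns. If neither chosen column is zero, the
  -- enumeration of the rest has this form, which is what the induction on the size uses.
  lift : ∀ {m n} → (Fin m → Fin n) → Fin (suc m) → Fin (suc n)
  lift φ zero    = zero
  lift φ (suc i) = suc (φ i)

  -- Splitting off the terms with j or k zero, which cancel by symmetry, leaves
  -- the same sum one size smaller.
  pairs-symmetric : ∀ n F →
    (∀ j l φ → F j l φ ≈ F l j φ) → (∀ j l {φ ψ} → φ ≗ ψ → F j l φ ≈ F j l ψ) →
    pairs n F ≈ 0#
  pairs-symmetric-suc : ∀ n F →
    (∀ j l φ → F j l φ ≈ F l j φ) → (∀ j l {φ ψ} → φ ≗ ψ → F j l φ ≈ F j l ψ) →
    (∑ λ j → sgn (toℕ j) * ∑ λ k → sgn (toℕ k) *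
      F (suc j) (suc (punchIn j k)) (punchIn (suc j) ∘ punchIn (suc k))) ≈ 0#

  pairs-symmetric n F sym-F ext-F = begin
    pairs n F
      ≈⟨ ∑-suc _ ⟩
    1# * ∑ (λ k → sgn (toℕ k) * F zero (suc k) (suc ∘ punchIn k)) + _
      ≈⟨ +-cong (trans (*-identityˡ _) (∑-cong first)) (∑-cong second) ⟩
    ∑ X + ∑ (λ j → - X j + Y j)
      ≈⟨ ∑-+ X _ ⟨
    ∑ (λ j → X j + (- X j + Y j))
      ≈⟨ ∑-cong cancel ⟩
    ∑ Y
      ≈⟨ pairs-symmetric-suc n F sym-F ext-F ⟩
    0# ∎
    where
    G : Fin (suc n) → Fin n → Carrier
    G j k = F (suc j) (suc (punchIn j k)) (punchIn (suc j) ∘ punchIn (suc k))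
    X Y : Fin (suc n) → Carrier
    X j = sgn (toℕ j) * F (suc j) zero (suc ∘ punchIn j)
    Y j = sgn (toℕ j) * ∑ λ k → sgn (toℕ k) * G j k
    first : ∀ k → sgn (toℕ k) * F zero (suc k) (suc ∘ punchIn k) ≈ X k
    first k = *-congˡ (sym-F zero (suc k) (suc ∘ punchIn k))
    cancel : ∀ j → X j + (- X j + Y j) ≈ Y j
    cancel j = trans (sym (+-assoc _ _ _)) (trans (+-congʳ (-‿inverseʳ _)) (+-identityˡ _))
    inner : ∀ j → - sgn (toℕ j) * ∑ (λ k → - sgn (toℕ k) * G j k) ≈ Y j
    inner j = begin
      - s * ∑ (λ k → - sgn (toℕ k) * G j k)       ≈⟨ -‿distribˡ-* _ _ ⟨
      - (s * ∑ (λ k → - sgn (toℕ k) * G j k))     ≈⟨ -‿distribʳ-* _ _ ⟩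
      s * - ∑ (λ k → - sgn (toℕ k) * G j k)       ≈⟨ *-congˡ (-‿∑ _) ⟩
      s * ∑ (λ k → - (- sgn (toℕ k) * G j k))
        ≈⟨ *-congˡ (∑-cong λ k → trans (-‿distribˡ-* _ _) (*-congʳ (-‿involutive _))) ⟩
      Y j ∎
      where s = sgn (toℕ j)
    second : ∀ j → - sgn (toℕ j) * ∑ (λ k → sgn (toℕ k) *
      F (suc j) (punchIn (suc j) k) (punchIn (suc j) ∘ punchIn k)) ≈ - X j + Y j
    second j = trans (*-congˡ (∑-suc _)) (trans (distribˡ (- sgn (toℕ j)) _ _) (+-cong
      (begin
        - sgn (toℕ j) * (1# * F (suc j) zero (punchIn (suc j) ∘ suc))
          ≈⟨ *-congˡ (trans (*-identityˡ _) (ext-F _ _ λ _ → ≡.refl)) ⟩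
        - sgn (toℕ j) * F (suc j) zero (suc ∘ punchIn j)
          ≈⟨ -‿distribˡ-* _ _ ⟨
        - X j ∎)
      (inner j)))

  pairs-symmetric-suc zero    F sym-F ext-F =
    trans (∑-cong λ j → trans (*-congˡ (∑-zero _)) (zeroʳ _)) (∑-0 1)
  pairs-symmetric-suc (suc n) F sym-F ext-F = trans
    (∑-cong λ j → *-congˡ (∑-cong λ k → *-congˡ
      (ext-F (suc j) (suc (punchIn j k)) {ψ = lift (punchIn j ∘ punchIn k)}
        λ { zero → ≡.refl ; (suc c) → ≡.refl })))
    (pairs-symmetric n (λ j l φ → F (suc j) (suc l) (lift φ))
      (λ j l φ → sym-F (suc j) (suc l) (lift φ))
      (λ j l φ≗ψ → ext-F (suc j) (suc l) λ { zero → ≡.refl ; (suc c) → ≡.cong suc (φ≗ψ c) }))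

  rows : ∀ {n} → Vector Carrier (2 ℕ.+ n) → Vector Carrier (2 ℕ.+ n) → Matrix n (2 ℕ.+ n) →
    Fin (2 ℕ.+ n) → Fin (2 ℕ.+ n) → (Fin n → Fin (2 ℕ.+ n)) → Carrier
  rows {n} u v N j l φ = u j * (v l * det n (λ r c → N r (φ c)))

  det-pairs : ∀ {n} u v (N : Matrix n (2 ℕ.+ n)) → det (2 ℕ.+ n) (u ∷ v ∷ N) ≈ pairs n (rows u v N)
  det-pairs {n} u v N = trans (det-∷ (suc n) u (v ∷ N)) (∑-cong λ j → *-congˡ (trans
    (*-congˡ (det-suc n (minor j (v ∷ N)))) (trans
    (*-∑ (u j) _)
    (∑-cong λ k → solve 4 (λ u s v d → u :* (s :* (v :* d)) := s :* (u :* (v :* d))) refl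
      (u j) (sgn (toℕ k)) _ _))))

  rows-ext : ∀ {n} u v (N : Matrix n (2 ℕ.+ n)) j l {φ ψ} → φ ≗ ψ → rows u v N j l φ ≈ rows u v N j l ψ
  rows-ext {n} u v N j l φ≗ψ = *-congˡ (*-congˡ (det-cong n λ r c → reflexive (≡.cong (N r) (φ≗ψ c))))

  rows-comm : ∀ {n} u v (N : Matrix n (2 ℕ.+ n)) j l φ → rows u v N j l φ ≈ rows v u N l j φ
  rows-comm u v N j l φ = solve 3 (λ a b d → a :* (b :* d) := b :* (a :* d)) refl (u j) (v l) _

  -- The summand of the double expansion is symmetric in the two columns, so its terms cancel in
  -- pairs. Concluding from D = -D would instead require 2 to be cancellable in the ring.
  det-equal-rows : ∀ {n} u (N : Matrix n (2 ℕ.+ n)) → det (2 ℕ.+ n) (u ∷ u ∷ N) ≈ 0#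
  det-equal-rows u N = trans (det-pairs u u N)
    (pairs-symmetric _ (rows u u N) (rows-comm u u N) (rows-ext u u N))

  pairs-+ : ∀ n F G → pairs n (λ j l φ → F j l φ + G j l φ) ≈ pairs n F + pairs n G
  pairs-+ n F G = trans
    (∑-cong λ j → trans
      (*-congˡ (trans (∑-cong λ k → distribˡ (sgn (toℕ k)) _ _) (∑-+ _ _)))
      (distribˡ (sgn (toℕ j)) _ _))
    (∑-+ _ _)

  -- Exchanging the rows exchanges the columns in the summand. The two summands together are
  -- therefore symmetric, and the sum of both determinants vanishes.
  det-swap-rows : ∀ {n} u v (N : Matrix n (2 ℕ.+ n)) →
    det (2 ℕ.+ n) (u ∷ v ∷ N) ≈ - det (2 ℕ.+ n) (v ∷ u ∷ N)
  det-swap-rows {n} u v N = +-inverseˡ-unique _ _ (begin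
    det (2 ℕ.+ n) (u ∷ v ∷ N) + det (2 ℕ.+ n) (v ∷ u ∷ N)
      ≈⟨ +-cong (det-pairs u v N) (det-pairs v u N) ⟩
    pairs n (rows u v N) + pairs n (rows v u N)
      ≈⟨ pairs-+ n (rows u v N) (rows v u N) ⟨
    pairs n (λ j l φ → rows u v N j l φ + rows v u N j l φ)
      ≈⟨ pairs-symmetric n _
           (λ j l φ → trans (+-cong (rows-comm u v N j l φ) (rows-comm v u N j l φ)) (+-comm _ _))
           (λ j l φ≗ψ → +-cong (rows-ext u v N j l φ≗ψ) (rows-ext v u N j l φ≗ψ)) ⟩
    0# ∎)

  det-linear-head : ∀ {n} u v a (N : Matrix n (suc n)) →
    det (suc n) ((λ j → u j + a * v j) ∷ N) ≈ det (suc n) (u ∷ N) + a * det (suc n) (v ∷ N)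
  det-linear-head {n} u v a N = begin
    det (suc n) ((λ j → u j + a * v j) ∷ N)
      ≈⟨ det-∷ n _ N ⟩
    ∑ (λ j → sgn (toℕ j) * ((u j + a * v j) * d j))
      ≈⟨ ∑-cong (λ j → solve 5 (λ s u a v d → s :* ((u :+ a :* v) :* d) :=
           s :* (u :* d) :+ a :* (s :* (v :* d))) refl (sgn (toℕ j)) (u j) a (v j) (d j)) ⟩
    ∑ (λ j → sgn (toℕ j) * (u j * d j) + a * (sgn (toℕ j) * (v j * d j)))
      ≈⟨ ∑-+ _ _ ⟩
    ∑ (λ j → sgn (toℕ j) * (u j * d j)) + ∑ (λ j → a * (sgn (toℕ j) * (v j * d j)))
      ≈⟨ +-cong (det-∷ n u N) (trans (*-congˡ (det-∷ n v N)) (*-∑ a _)) ⟨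
    det (suc n) (u ∷ N) + a * det (suc n) (v ∷ N) ∎
    where
    d : Fin (suc n) → Carrier
    d j = det n (minor j N)

  -- The first row below the head is cleared by linearity, its extra part being a repeated row.
  -- Swapping that row to the top then leaves `v` as the head of every minor but with one column
  -- deleted, and the induction hypothesis clears the other rows.
  det-add-head : ∀ {n} v (c : Vector Carrier n) (N : Matrix n (suc n)) →
    det (suc n) (v ∷ λ i j → N i j + c i * v j) ≈ det (suc n) (v ∷ N)
  det-add-head {zero}  v c N = det-head-tail 0 (λ _ → refl) λ ()
  det-add-head {suc n} v c N = begin
    det (2 ℕ.+ n) (v ∷ λ i j → N i j + c i * v j)
      ≈⟨ det-cong (2 ℕ.+ n) (λ { zero j → refl ; (suc zero) j → refl ; (suc (suc i)) j → refl }) ⟩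
    det (2 ℕ.+ n) (v ∷ w ∷ N⁺)
      ≈⟨ det-swap-rows v w N⁺ ⟩
    - det (2 ℕ.+ n) (w ∷ v ∷ N⁺)
      ≈⟨ -‿cong (det-linear-head u v (c zero) (v ∷ N⁺)) ⟩
    - (det (2 ℕ.+ n) (u ∷ v ∷ N⁺) + c zero * det (2 ℕ.+ n) (v ∷ v ∷ N⁺))
      ≈⟨ -‿cong (trans (+-congˡ (trans (*-congˡ (det-equal-rows v N⁺)) (zeroʳ _))) (+-identityʳ _)) ⟩
    - det (2 ℕ.+ n) (u ∷ v ∷ N⁺)
      ≈⟨ -‿cong (trans (det-∷ (suc n) u (v ∷ N⁺)) (trans
           (∑-cong λ j → *-congˡ (*-congˡ (minors j)))
           (sym (det-∷ (suc n) u (v ∷ tail N))))) ⟩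
    - det (2 ℕ.+ n) (u ∷ v ∷ tail N)
      ≈⟨ det-swap-rows v u (tail N) ⟨
    det (2 ℕ.+ n) (v ∷ u ∷ tail N)
      ≈⟨ det-cong (2 ℕ.+ n) (λ { zero j → refl ; (suc zero) j → refl ; (suc (suc i)) j → refl }) ⟩
    det (2 ℕ.+ n) (v ∷ N) ∎
    where
    u w : Vector Carrier (2 ℕ.+ n)
    u = N zero
    w j = N zero j + c zero * v j
    N⁺ : Matrix n (2 ℕ.+ n)
    N⁺ i j = N (suc i) j + c (suc i) * v j
    minors : ∀ j → det (suc n) (minor j (v ∷ N⁺)) ≈ det (suc n) (minor j (v ∷ tail N))
    minors j = trans
      (det-head-tail n (λ _ → refl) λ _ _ → refl) (trans
      (det-add-head (λ k → v (punchIn j k)) (tail c) (minor j (tail N)))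
      (sym (det-head-tail n (λ _ → refl) λ _ _ → refl)))

  -- Multiplication on the left by a unit lower triangular matrix. The multiples of row 0 are
  -- removed by `det-add-head`; what remains in each minor is again such a product, with `T` shifted
  -- along its diagonal.
  det-unit-lower : ∀ n (T : ℕ → ℕ → Carrier) (r : ℕ → Vector Carrier n) → (∀ i → T i i ≈ 1#) →
    det n (λ i j → ∑ {suc (toℕ i)} λ k → T (toℕ i) (toℕ k) * r (toℕ k) j) ≈ det n (λ i j → r (toℕ i) j)
  det-unit-lower zero    T r T≈1 = det-cong 0 λ ()
  det-unit-lower (suc n) T r T≈1 = begin
    det (suc n) (λ i j → ∑ {suc (toℕ i)} λ k → T (toℕ i) (toℕ k) * r (toℕ k) j)
      ≈⟨ det-head-tail n
           (λ j → trans (∑-suc _) (trans (+-cong (trans (*-congʳ (T≈1 0)) (*-identityˡ _)) (∑-zero _))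
             (+-identityʳ _)))
           (λ i j → trans (∑-suc _) (+-comm _ _)) ⟩
    det (suc n) (r 0 ∷ λ i j → N i j + T (suc (toℕ i)) 0 * r 0 j)
      ≈⟨ det-add-head (r 0) (λ i → T (suc (toℕ i)) 0) N ⟩
    det (suc n) (r 0 ∷ N)
      ≈⟨ det-∷ n (r 0) N ⟩
    ∑ (λ j → sgn (toℕ j) * (r 0 j * det n (minor j N)))
      ≈⟨ ∑-cong (λ j → *-congˡ (*-congˡ
           (det-unit-lower n (λ i k → T (suc i) (suc k)) (λ k c → r (suc k) (punchIn j c))
             (λ i → T≈1 (suc i))))) ⟩
    ∑ (λ j → sgn (toℕ j) * (r 0 j * det n (λ i c → r (suc (toℕ i)) (punchIn j c))))
      ≈⟨ det-suc n _ ⟨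
    det (suc n) (λ i j → r (toℕ i) j) ∎
    where
    N : Matrix n (suc n)
    N i j = ∑ {suc (toℕ i)} λ k → T (suc (toℕ i)) (suc (toℕ k)) * r (suc (toℕ k)) j

  -- Expanding along the first row, and every minor but the first along its first column, gives a
  -- double sum in which rows and columns play the same part; exchanging the summations gives the
  -- expansion along the column.
  det-column : ∀ n (M : Matrix (suc n) (suc n)) →
    det (suc n) M ≈ ∑ λ i → sgn (toℕ i) * (M i zero * det n (λ r c → M (punchIn i r) (suc c)))
  det-column zero    M = trans (det-suc 0 M) (∑-cong λ { zero → *-congˡ (*-congˡ (det-cong 0 λ ())) })
  det-column (suc n) M = trans (det-suc (suc n) M) (trans (∑-suc _) (trans (+-congˡ (begin
    ∑ (λ j → - s j * (a j * det (suc n) (minor (suc j) (tail M))))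
      ≈⟨ ∑-cong (λ j → *-congˡ (*-congˡ (det-column n (minor (suc j) (tail M))))) ⟩
    ∑ (λ j → - s j * (a j * ∑ λ i → s i * (b i * d i j)))
      ≈⟨ ∑-cong (λ j → pull-in (s j) (a j) _) ⟩
    ∑ (λ j → ∑ λ i → - (s j * (a j * (s i * (b i * d i j)))))
      ≈⟨ ∑-comm _ ⟩
    ∑ (λ i → ∑ λ j → - (s j * (a j * (s i * (b i * d i j)))))
      ≈⟨ ∑-cong (λ i → trans
           (∑-cong λ j → -‿cong (solve 5
             (λ s a t b d → s :* (a :* (t :* (b :* d))) := t :* (b :* (s :* (a :* d)))) refl
             (s j) (a j) (s i) (b i) (d i j)))
           (sym (pull-in (s i) (b i) _))) ⟩
    ∑ (λ i → - s i * (b i * ∑ λ j → s j * (a j * d i j)))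
      ≈⟨ ∑-cong (λ i → *-congˡ (*-congˡ (det-suc n _))) ⟨
    ∑ (λ i → - s i * (b i * det (suc n) (λ r c → M (punchIn (suc i) r) (suc c)))) ∎))
    (sym (∑-suc _))))
    where
    s : Fin (suc n) → Carrier
    s j = sgn (toℕ j)
    a b : Fin (suc n) → Carrier
    a j = M zero (suc j)
    b i = M (suc i) zero
    d : Matrix (suc n) (suc n)
    d i j = det n (λ r c → M (suc (punchIn i r)) (suc (punchIn j c)))
    pull-in : ∀ x y (f : Fin (suc n) → Carrier) → - x * (y * ∑ f) ≈ ∑ (λ k → - (x * (y * f k)))
    pull-in x y f = trans (*-congˡ (*-∑ y f)) (trans (*-∑ (- x) _)
      (∑-cong λ k → sym (-‿distribˡ-* x (y * f k))))

  det-transpose : ∀ n (M : Matrix n n) → det n (λ i j → M j i) ≈ det n M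
  det-transpose zero    M = det-cong 0 λ ()
  det-transpose (suc n) M = trans (det-suc n _) (trans
    (∑-cong λ j → *-congˡ (*-congˡ (det-transpose n (λ r c → M (punchIn j r) (suc c)))))
    (sym (det-column n M)))

  det-column-zero : ∀ n (M : Matrix (suc n) (suc n)) → (∀ i → M (suc i) zero ≈ 0#) →
    det (suc n) M ≈ M zero zero * det n (λ i j → M (suc i) (suc j))
  det-column-zero n M zeros = trans (det-column n M) (trans (∑-suc _) (trans
    (+-cong (*-identityˡ _) (trans
      (∑-cong λ i → trans (*-congˡ (trans (*-congʳ (zeros i)) (zeroˡ _))) (zeroʳ _))
      (∑-0 n)))
    (+-identityʳ _)))

  det-scale-rows : ∀ n (a : Vector Carrier n) (M : Matrix n n) →
    det n (λ i j → a i * M i j) ≈ ∏ a * det n M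
  det-scale-rows zero    a M = trans (det-cong 0 λ ()) (sym (trans (*-congʳ (∏-zero a)) (*-identityˡ _)))
  det-scale-rows (suc n) a M = trans (det-suc n _) (trans
    (∑-cong λ j → trans
      (*-congˡ (*-congˡ (det-scale-rows n (tail a) (minor j (tail M)))))
      (solve 5 (λ s a m p d → s :* (a :* m :* (p :* d)) := (a :* p) :* (s :* (m :* d))) refl
        (sgn (toℕ j)) (a zero) (M zero j) (∏ (tail a)) _))
    (sym (trans (*-cong (∏-suc a) (det-suc n M)) (*-∑ _ _))))

  det-scale-columns : ∀ n (b : Vector Carrier n) (M : Matrix n n) →
    det n (λ i j → b j * M i j) ≈ ∏ b * det n M
  det-scale-columns n b M = begin
    det n (λ i j → b j * M i j)   ≈⟨ det-transpose n (λ i j → b j * M i j) ⟨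
    det n (λ i j → b i * M j i)   ≈⟨ det-scale-rows n b (λ i j → M j i) ⟩
    ∏ b * det n (λ i j → M j i)   ≈⟨ *-congˡ (det-transpose n M) ⟩
    ∏ b * det n M                 ∎

-- Sequences as linear functionals on polynomials

module Sequences {c ℓ} (R : CommutativeRing c ℓ) where

  open CommutativeRing R hiding (zero)
  open Determinant R
  open import Algebra.Properties.Semiring.Exp semiring using (_^_)
  open import Algebra.Properties.Semiring.Mult semiring using (×-homo-+; ×-congʳ; ×-congˡ; ×-comm-*) renaming (_×_ to _·_)
  open import Algebra.Solver.Ring.NaturalCoefficients.Default commutativeSemiring
    using (solve; _:=_; _:+_; _:*_; con)
  open import Relation.Binary.Reasoning.Setoid setoid

  Seq : Set c
  Seq = ℕ → Carrier

  infix 4 _≐_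
  _≐_ : Seq → Seq → Set ℓ
  s ≐ t = ∀ m → s m ≈ t m

  shift : Seq → Seq
  shift s m = s (suc m)

  infixl 6 _⊹_
  _⊹_ : Carrier → (Seq → Seq) → Seq → Seq
  (v ⊹ A) s m = v * s m + A s m

  -- A sequence s stands for the functional L with L[zᵐ] = s m; then
  -- newton shift v i s stands for p ↦ L[(z + v 0)...(z + v (i-1)) p].
  newton : (Seq → Seq) → (ℕ → Carrier) → ℕ → Seq → Seq
  newton A v zero    s = s
  newton A v (suc i) s = (v i ⊹ A) (newton A v i s)

  record Linear (A : Seq → Seq) : Set (c ⊔ ℓ) where
    field
      cong   : ∀ {s t} → s ≐ t → A s ≐ A t
      linear : ∀ v s t → A (λ m → v * s m + t m) ≐ λ m → v * A s m + A t m

  module _ {A : Seq → Seq} (lin : Linear A) where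
    open Linear lin

    ⊹-linear : ∀ v → Linear (v ⊹ A)
    ⊹-linear v = record
      { cong   = λ s≐t m → +-cong (*-congˡ (s≐t m)) (cong s≐t m)
      ; linear = λ w s t m → trans (+-congˡ (linear w s t m))
          (solve 6 (λ v w s t a b → v :* (w :* s :+ t) :+ (w :* a :+ b) :=
            w :* (v :* s :+ a) :+ (v :* t :+ b)) refl v w (s m) (t m) (A s m) (A t m))
      }

    newton-linear : ∀ v i → Linear (newton A v i)
    newton-linear v zero    = record { cong = λ s≐t → s≐t ; linear = λ _ _ _ _ → refl }
    newton-linear v (suc i) = record
      { cong   = λ s≐t → Linear.cong (⊹-linear (v i)) (Linear.cong (newton-linear v i) s≐t)
      ; linear = λ w s t m → trans
          (Linear.cong (⊹-linear (v i)) (Linear.linear (newton-linear v i) w s t) m)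
          (Linear.linear (⊹-linear (v i)) w _ _ m)
      }

    newton-comm : ∀ {B : Seq → Seq} → Linear B → (∀ s → A (B s) ≐ B (A s)) →
      ∀ v i s → newton A v i (B s) ≐ B (newton A v i s)
    newton-comm linB AB v zero    s m = refl
    newton-comm linB AB v (suc i) s m = begin
      v i * newton A v i _ m + A (newton A v i _) m
        ≈⟨ Linear.cong (⊹-linear (v i)) (newton-comm linB AB v i s) m ⟩
      v i * _ + A _ m
        ≈⟨ +-congˡ (AB _ m) ⟩
      v i * _ + _
        ≈⟨ Linear.linear linB (v i) _ _ m ⟨
      _ ∎

    -- If `A` is multiplication by a polynomial a(z), these are the moments L[a(z)ᵏ], that is, the
    -- functional read in the variable a. The powers of `A` are `newton` with zero nodes, so the
    -- lemmas on `newton` apply to them.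
    orbit : Seq → Seq
    orbit s k = newton A (λ _ → 0#) k s 0

    orbit-⊹ : ∀ v s → (v ⊹ shift) (orbit s) ≐ orbit ((v ⊹ A) s)
    orbit-⊹ v s k = begin
      v * Aᵏ s 0 + (0# * Aᵏ s 0 + A (Aᵏ s) 0)
        ≈⟨ +-congˡ (trans (+-congʳ (zeroˡ _)) (+-identityˡ _)) ⟩
      v * Aᵏ s 0 + A (Aᵏ s) 0
        ≈⟨ +-congˡ (newton-comm lin (λ _ _ → refl) (λ _ → 0#) k s 0) ⟨
      v * Aᵏ s 0 + Aᵏ (A s) 0
        ≈⟨ Linear.linear (newton-linear (λ _ → 0#) k) v s (A s) 0 ⟨
      orbit ((v ⊹ A) s) k ∎
      where
      Aᵏ : Seq → Seq
      Aᵏ = newton A (λ _ → 0#) k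

  shift-linear : Linear shift
  shift-linear = record { cong = λ s≐t m → s≐t (suc m) ; linear = λ _ _ _ _ → refl }

  newton-orbit : ∀ {A} (lin : Linear A) v i s →
    newton shift v i (orbit lin s) ≐ orbit lin (newton A v i s)
  newton-orbit lin v zero    s m = refl
  newton-orbit lin v (suc i) s m = trans
    (Linear.cong (⊹-linear shift-linear (v i)) (newton-orbit lin v i s) m)
    (orbit-⊹ lin (v i) _ m)

  newton-cong : ∀ {v w} → v ≐ w → ∀ i s → newton shift v i s ≐ newton shift w i s
  newton-cong v≐w zero    s m = refl
  newton-cong v≐w (suc i) s m =
    +-cong (*-cong (v≐w i) (newton-cong v≐w i s m)) (newton-cong v≐w i s (suc m))

  -- The coefficient of zᵏ in (z + v 0)...(z + v (i-1)).
  coefficient : (ℕ → Carrier) → ℕ → ℕ → Carrier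
  coefficient v zero    zero    = 1#
  coefficient v zero    (suc k) = 0#
  coefficient v (suc i) zero    = v i * coefficient v i zero
  coefficient v (suc i) (suc k) = v i * coefficient v i (suc k) + coefficient v i k

  coefficient-above : ∀ v {i k} → i ℕ.< k → coefficient v i k ≈ 0#
  coefficient-above v {zero}  {suc k} i<k = refl
  coefficient-above v {suc i} {suc k} i<k = trans
    (+-cong (trans (*-congˡ (coefficient-above v (ℕₚ.m<n⇒m<1+n (ℕ.s<s⁻¹ i<k)))) (zeroʳ _))
      (coefficient-above v (ℕ.s<s⁻¹ i<k)))
    (+-identityˡ _)

  coefficient-diagonal : ∀ v i → coefficient v i i ≈ 1#
  coefficient-diagonal v zero    = refl
  coefficient-diagonal v (suc i) = trans
    (+-cong (trans (*-congˡ (coefficient-above v (ℕₚ.n<1+n i))) (zeroʳ _)) (coefficient-diagonal v i))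
    (+-identityˡ _)

  newton-expand : ∀ v i s m →
    newton shift v i s m ≈ ∑ {suc i} λ k → coefficient v i (toℕ k) * s (toℕ k ℕ.+ m)
  newton-expand v zero    s m = sym (trans (∑-suc _) (trans
    (+-cong (*-identityˡ _) (∑-zero _)) (+-identityʳ _)))
  newton-expand v (suc i) s m = begin
    v i * newton shift v i s m + newton shift v i s (suc m)
      ≈⟨ +-cong (*-congˡ (trans (newton-expand v i s m) extend)) (newton-expand v i s (suc m)) ⟩
    v i * ∑ {2 ℕ.+ i} (λ k → T (toℕ k) * s (toℕ k ℕ.+ m)) + ∑ {suc i} (λ k → T (toℕ k) * s (toℕ k ℕ.+ suc m))
      ≈⟨ +-cong (*-congˡ (∑-suc _)) (∑-cong {suc i} λ k → *-congˡ (reflexive (≡.cong s (ℕₚ.+-suc (toℕ k) m)))) ⟩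
    v i * (T 0 * s m + ∑ {suc i} (λ k → T (suc (toℕ k)) * s⁺ k)) + ∑ {suc i} (λ k → T (toℕ k) * s⁺ k)
      ≈⟨ solve 5 (λ v t s x y → v :* (t :* s :+ x) :+ y := (v :* t) :* s :+ (v :* x :+ y)) refl
           (v i) (T 0) (s m) _ _ ⟩
    (v i * T 0) * s m + (v i * ∑ {suc i} (λ k → T (suc (toℕ k)) * s⁺ k) + ∑ {suc i} (λ k → T (toℕ k) * s⁺ k))
      ≈⟨ +-congˡ (trans (+-congʳ (*-∑ _ _)) (sym (∑-+ _ _))) ⟩
    (v i * T 0) * s m + ∑ {suc i} (λ k → v i * (T (suc (toℕ k)) * s⁺ k) + T (toℕ k) * s⁺ k)
      ≈⟨ +-congˡ (∑-cong λ k → solve 4 (λ v t u s → v :* (t :* s) :+ u :* s := (v :* t :+ u) :* s) refl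
           (v i) (T (suc (toℕ k))) (T (toℕ k)) (s⁺ k)) ⟩
    (v i * T 0) * s m + ∑ {suc i} (λ k → (v i * T (suc (toℕ k)) + T (toℕ k)) * s⁺ k)
      ≈⟨ ∑-suc _ ⟨
    ∑ {2 ℕ.+ i} (λ k → coefficient v (suc i) (toℕ k) * s (toℕ k ℕ.+ m)) ∎
    where
    T : ℕ → Carrier
    T = coefficient v i
    s⁺ : Fin (suc i) → Carrier
    s⁺ k = s (suc (toℕ k) ℕ.+ m)
    -- A vanishing top term is appended so that, after the constant term is split off, this sum
    -- matches the shifted one index by index.
    extend : ∑ {suc i} (λ k → T (toℕ k) * s (toℕ k ℕ.+ m)) ≈ ∑ {2 ℕ.+ i} (λ k → T (toℕ k) * s (toℕ k ℕ.+ m))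
    extend = sym (trans (∑-last (suc i) (λ k → T k * s (k ℕ.+ m))) (trans
      (+-congˡ (trans (*-congʳ (coefficient-above v (ℕₚ.n<1+n i))) (zeroˡ _))) (+-identityʳ _)))

  -- The products of the z + v k and of the z + w k are two monic bases, so each differs from the
  -- powers of z by a unit lower triangular matrix: one acts on the rows and, after transposing, the
  -- other on the columns.
  det-newton : ∀ n v w s →
    det n (λ i j → newton shift v (toℕ i) (newton shift w (toℕ j) s) 0) ≈ det n (λ i j → s (toℕ i ℕ.+ toℕ j))
  det-newton n v w s = begin
    det n (λ i j → newton shift v (toℕ i) (newton shift w (toℕ j) s) 0)
      ≈⟨ det-cong n (λ i j → trans (newton-expand v (toℕ i) (newton shift w (toℕ j) s) 0)
           (∑-cong λ k → *-congˡ (reflexive (≡.cong (newton shift w (toℕ j) s) (ℕₚ.+-identityʳ (toℕ k)))))) ⟩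
    det n (λ i j → ∑ {suc (toℕ i)} λ k → coefficient v (toℕ i) (toℕ k) * newton shift w (toℕ j) s (toℕ k))
      ≈⟨ det-unit-lower n (coefficient v) (λ k j → newton shift w (toℕ j) s k) (coefficient-diagonal v) ⟩
    det n (λ i j → newton shift w (toℕ j) s (toℕ i))
      ≈⟨ det-transpose n _ ⟨
    det n (λ i j → newton shift w (toℕ i) s (toℕ j))
      ≈⟨ det-cong n (λ i j → newton-expand w (toℕ i) s (toℕ j)) ⟩
    det n (λ i j → ∑ {suc (toℕ i)} λ k → coefficient w (toℕ i) (toℕ k) * s (toℕ k ℕ.+ toℕ j))
      ≈⟨ det-unit-lower n (coefficient w) (λ k j → s (k ℕ.+ toℕ j)) (coefficient-diagonal w) ⟩
    det n (λ i j → s (toℕ i ℕ.+ toℕ j)) ∎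

  -- Multiplication by z(z + 2y) = (y + z)² - y².
  quadratic : Carrier → Seq → Seq
  quadratic y s m = (y + y) * s (suc m) + s (2 ℕ.+ m)

  quadratic-linear : ∀ y → Linear (quadratic y)
  quadratic-linear y = record
    { cong   = λ s≐t m → Linear.cong (⊹-linear shift-linear (y + y)) s≐t (suc m)
    ; linear = λ v s t m → Linear.linear (⊹-linear shift-linear (y + y)) v s t (suc m)
    }

  newton-quadratic : ∀ y i s → newton (quadratic y) (λ _ → y * y) i s ≐ newton shift (λ _ → y) (i ℕ.+ i) s
  newton-quadratic y zero    s m = refl
  newton-quadratic y (suc i) s m = begin
    (y * y ⊹ quadratic y) (newton (quadratic y) (λ _ → y * y) i s) m
      ≈⟨ Linear.cong (⊹-linear (quadratic-linear y) (y * y)) (newton-quadratic y i s) m ⟩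
    y * y * t m + ((y + y) * t (suc m) + t (2 ℕ.+ m))
      ≈⟨ solve 4 (λ y a b c → y :* y :* a :+ ((y :+ y) :* b :+ c) :=
           y :* (y :* a :+ b) :+ (y :* b :+ c)) refl y (t m) (t (suc m)) (t (2 ℕ.+ m)) ⟩
    newton shift (λ _ → y) (2 ℕ.+ (i ℕ.+ i)) s m
      ≡⟨ ≡.cong (λ k → newton shift (λ _ → y) (suc k) s m) (ℕₚ.+-suc i i) ⟨
    newton shift (λ _ → y) (suc i ℕ.+ suc i) s m ∎
    where
    t : Seq
    t = newton shift (λ _ → y) (i ℕ.+ i) s

  newton-+ : ∀ y i j s → newton shift (λ _ → y) (i ℕ.+ j) s ≡ newton shift (λ _ → y) i (newton shift (λ _ → y) j s)
  newton-+ y zero    j s = ≡.refl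
  newton-+ y (suc i) j s = ≡.cong (y ⊹ shift) (newton-+ y i j s)

  -- With w = (y + z)² and c k = (w - y²)ᵏ, the powers of w are a binomial
  -- transform of c.
  det-even : ∀ n y s →
    det n (λ i j → newton shift (λ _ → y) (2 ℕ.* (toℕ i ℕ.+ toℕ j)) s 0) ≈
    det n (λ i j → orbit (quadratic-linear y) s (toℕ i ℕ.+ toℕ j))
  det-even n y s = begin
    det n (λ i j → Y (2 ℕ.* (toℕ i ℕ.+ toℕ j)) s 0)
      ≈⟨ det-cong n (λ i j → entry (toℕ i) (toℕ j)) ⟩
    det n (λ i j → newton shift y² (toℕ i) (newton shift y² (toℕ j) (orbit lin s)) 0)
      ≈⟨ det-newton n y² y² (orbit lin s) ⟩
    det n (λ i j → orbit lin s (toℕ i ℕ.+ toℕ j)) ∎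
    where
    y² : ℕ → Carrier
    y² _ = y * y
    lin : Linear (quadratic y)
    lin = quadratic-linear y
    Y : ℕ → Seq → Seq
    Y = newton shift (λ _ → y)
    W : ℕ → Seq → Seq
    W = newton (quadratic y) y²
    entry : ∀ i j → Y (2 ℕ.* (i ℕ.+ j)) s 0 ≈ newton shift y² i (newton shift y² j (orbit lin s)) 0
    entry i j = begin
      Y (2 ℕ.* (i ℕ.+ j)) s 0
        ≡⟨ ≡.cong (λ k → Y k s 0) (ℕ-solve 2 (λ i j → ℕ-con 2 ⊗ (i ⊕ j) ⊜ (i ⊕ i) ⊕ (j ⊕ j)) ≡.refl i j) ⟩
      Y ((i ℕ.+ i) ℕ.+ (j ℕ.+ j)) s 0
        ≡⟨ ≡.cong (λ t → t 0) (newton-+ y (i ℕ.+ i) (j ℕ.+ j) s) ⟩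
      Y (i ℕ.+ i) (Y (j ℕ.+ j) s) 0
        ≈⟨ newton-quadratic y i _ 0 ⟨
      W i (Y (j ℕ.+ j) s) 0
        ≈⟨ Linear.cong (newton-linear lin y² i) (newton-quadratic y j s) 0 ⟨
      W i (W j s) 0
        ≈⟨ newton-orbit lin y² i (W j s) 0 ⟨
      newton shift y² i (orbit lin (W j s)) 0
        ≈⟨ Linear.cong (newton-linear shift-linear y² i) (newton-orbit lin y² j s) 0 ⟨
      newton shift y² i (newton shift y² j (orbit lin s)) 0 ∎

  coefficient-binomial : ∀ y i k → coefficient (λ _ → y) i k ≈ (i C k) · (y ^ (i ∸ k))
  coefficient-binomial y zero    zero    = sym (+-identityʳ 1#)
  coefficient-binomial y zero    (suc k) = refl
  coefficient-binomial y (suc i) zero    = trans (*-congˡ (coefficient-binomial y i 0))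
    (solve 2 (λ y p → y :* (p :+ con 0) := y :* p :+ con 0) refl y (y ^ i))
  coefficient-binomial y (suc i) (suc k) = begin
    y * coefficient (λ _ → y) i (suc k) + coefficient (λ _ → y) i k
      ≈⟨ +-cong (trans (*-congˡ (coefficient-binomial y i (suc k))) (step (ℕₚ.≤-<-connex i k)))
           (coefficient-binomial y i k) ⟩
    (i C suc k) · p + (i C k) · p
      ≈⟨ ×-homo-+ p (i C suc k) (i C k) ⟨
    (i C suc k ℕ.+ i C k) · p
      ≈⟨ ×-congˡ (≡.trans (ℕₚ.+-comm (i C suc k) (i C k)) (nCk+nC[k+1]≡[n+1]C[k+1] i k)) ⟩
    (suc i C suc k) · p ∎
    where
    p : Carrier
    p = y ^ (i ∸ k)
    -- For i ≤ k truncated subtraction makes both exponents 0, so the powers do not match; there the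
    -- binomial coefficient is zero.
    step : i ℕ.≤ k ⊎ k ℕ.< i → y * ((i C suc k) · (y ^ (i ∸ suc k))) ≈ (i C suc k) · p
    step (inj₁ i≤k) = begin
      y * ((i C suc k) · (y ^ (i ∸ suc k))) ≈⟨ *-congˡ (×-congˡ vanish) ⟩
      y * 0#                                ≈⟨ zeroʳ y ⟩
      0#                                    ≈⟨ ×-congˡ vanish ⟨
      (i C suc k) · p                       ∎
      where
      vanish : i C suc k ≡ 0
      vanish = k>n⇒nCk≡0 (ℕ.s≤s i≤k)
    step (inj₂ k<i) = trans (×-comm-* (i C suc k) y _)
      (×-congʳ (i C suc k) (reflexive (≡.cong (y ^_) (≡.sym (ℕₚ.+-∸-assoc 1 k<i)))))

-- The Hankel determinant of the Bernoulli numbers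

module HankelEvaluation {c ℓ} (R : CommutativeRing c ℓ) where

  open CommutativeRing R hiding (zero)
  open import Data.Vec.Functional using (Vector; _∷_)
  open Determinant R
  open Sequences R
  open import Algebra.Properties.Ring ring
    using (-‿distribˡ-*; -‿+-comm; -0#≈0#; +-cancelʳ)
  open import Algebra.Properties.Semiring.Mult semiring using (×-homo-+; ×-congˡ; ×1-homo-*) renaming (_×_ to _·_)
  open import Algebra.Solver.Ring.NaturalCoefficients.Default commutativeSemiring
    using (solve; _:=_; _:+_; _:*_; con)
  open import Relation.Binary.Reasoning.Setoid setoid

  -- The Hilbert matrix and its pivots

  ι : ℕ → Carrier
  ι n = n · 1#

  IsReciprocal : (ℕ → Carrier) → Set ℓ
  IsReciprocal r = ∀ n → ι (suc n) * r n ≈ 1#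

  -- The j-th pivot in the elimination of the matrix 1/(b+1+i+j). The square collects the factor
  -- (j+1)/(b+j+2) taken once from a row and once from a column of the Schur complement.
  hilbertFactor : (ℕ → Carrier) → ℕ → ℕ → Carrier
  hilbertFactor r b zero    = r b
  hilbertFactor r b (suc j) = (x * x) * hilbertFactor r (2 ℕ.+ b) j
    where
    x : Carrier
    x = ι (suc j) * r (suc b ℕ.+ j)

  module _ {r : ℕ → Carrier} (r-recip : IsReciprocal r) where

    -- This is (b+2+i)(b+2+j) = (i+1)(j+1) + (b+1)(b+3+i+j), divided by the product of the three
    -- denominators. The last summand is the multiple of the top row that clears the first column.
    schur-complement : ∀ b i j → r (2 ℕ.+ (b ℕ.+ (i ℕ.+ j))) ≈
      (ι (suc i) * r (suc b ℕ.+ i)) * ((ι (suc j) * r (suc b ℕ.+ j)) * r (2 ℕ.+ (b ℕ.+ (i ℕ.+ j))))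
        + (ι (suc b) * r (suc b ℕ.+ i)) * r (suc b ℕ.+ j)
    schur-complement b i j = begin
      γ                               ≈⟨ *-identityˡ γ ⟨
      1# * γ                          ≈⟨ *-congʳ (*-identityˡ 1#) ⟨
      (1# * 1#) * γ                   ≈⟨ *-congʳ (*-cong (r-recip _) (r-recip _)) ⟨
      ((A * α) * (B * β)) * γ         ≈⟨ solve 5 (λ a α b β γ → ((a :* α) :* (b :* β)) :* γ := (a :* b) :* (α :* β :* γ)) refl A α B β γ ⟩
      (A * B) * (α * β * γ)           ≈⟨ *-congʳ AB ⟩
      (I * J + a * K) * (α * β * γ)   ≈⟨ solve 7 (λ i j a c α β γ → (i :* j :+ a :* c) :* (α :* β :* γ) :=
                                           (i :* α) :* ((j :* β) :* γ) :+ (c :* γ) :* ((a :* α) :* β)) refl I J a K α β γ ⟩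
      (I * α) * ((J * β) * γ) + (K * γ) * ((a * α) * β)
        ≈⟨ +-congˡ (trans (*-congʳ (r-recip _)) (*-identityˡ _)) ⟩
      (I * α) * ((J * β) * γ) + (a * α) * β ∎
      where
      A B K I J a α β γ : Carrier
      A = ι (2 ℕ.+ b ℕ.+ i)
      B = ι (2 ℕ.+ b ℕ.+ j)
      K = ι (3 ℕ.+ (b ℕ.+ (i ℕ.+ j)))
      I = ι (suc i)
      J = ι (suc j)
      a = ι (suc b)
      α = r (suc b ℕ.+ i)
      β = r (suc b ℕ.+ j)
      γ = r (2 ℕ.+ (b ℕ.+ (i ℕ.+ j)))
      AB : A * B ≈ I * J + a * K
      AB = begin
        A * B
          ≈⟨ ×1-homo-* (2 ℕ.+ b ℕ.+ i) (2 ℕ.+ b ℕ.+ j) ⟨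
        ι ((2 ℕ.+ b ℕ.+ i) ℕ.* (2 ℕ.+ b ℕ.+ j))
          ≈⟨ ×-congˡ (ℕ-solve 3 (λ b i j → (ℕ-con 2 ⊕ b ⊕ i) ⊗ (ℕ-con 2 ⊕ b ⊕ j) ⊜
                 (ℕ-con 1 ⊕ i) ⊗ (ℕ-con 1 ⊕ j) ⊕ (ℕ-con 1 ⊕ b) ⊗ (ℕ-con 3 ⊕ (b ⊕ (i ⊕ j)))) ≡.refl b i j) ⟩
        ι (suc i ℕ.* suc j ℕ.+ suc b ℕ.* (3 ℕ.+ (b ℕ.+ (i ℕ.+ j))))
          ≈⟨ ×-homo-+ 1# (suc i ℕ.* suc j) _ ⟩
        ι (suc i ℕ.* suc j) + ι (suc b ℕ.* (3 ℕ.+ (b ℕ.+ (i ℕ.+ j))))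
          ≈⟨ +-cong (×1-homo-* (suc i) (suc j)) (×1-homo-* (suc b) (3 ℕ.+ (b ℕ.+ (i ℕ.+ j)))) ⟩
        I * J + a * K ∎

    det-hilbert : ∀ n b → det n (λ i j → r (b ℕ.+ (toℕ i ℕ.+ toℕ j))) ≈ ∏ {n} (λ j → hilbertFactor r b (toℕ j))
    det-hilbert zero    b = trans (det-zero _) (sym (∏-zero _))
    det-hilbert (suc n) b = begin
      det (suc n) (λ i j → r (b ℕ.+ (toℕ i ℕ.+ toℕ j)))
        ≈⟨ det-head-tail n (λ _ → refl) cleared ⟩
      det (suc n) (top ∷ λ i j → N i j + (ι (suc b) * r (suc b ℕ.+ toℕ i)) * top j)
        ≈⟨ det-add-head top (λ i → ι (suc b) * r (suc b ℕ.+ toℕ i)) N ⟩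
      det (suc n) (top ∷ N)
        ≈⟨ det-column-zero n (top ∷ N) (λ _ → refl) ⟩
      r (b ℕ.+ 0) * det n (λ i j → x i * (x j * r (2 ℕ.+ (b ℕ.+ (toℕ i ℕ.+ toℕ j)))))
        ≈⟨ *-cong (reflexive (≡.cong r (ℕₚ.+-identityʳ b)))
             (trans (det-scale-rows n x _) (*-congˡ (det-scale-columns n x _))) ⟩
      r b * (∏ x * (∏ x * det n (λ i j → r (2 ℕ.+ b ℕ.+ (toℕ i ℕ.+ toℕ j)))))
        ≈⟨ *-congˡ (*-congˡ (*-congˡ (det-hilbert n (2 ℕ.+ b)))) ⟩
      r b * (∏ x * (∏ x * ∏ h))
        ≈⟨ *-congˡ (trans (sym (*-assoc _ _ _)) (trans (*-congʳ (sym (∏-* x x))) (sym (∏-* _ h)))) ⟩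
      r b * ∏ (λ j → (x j * x j) * h j)
        ≈⟨ ∏-suc _ ⟨
      ∏ (λ j → hilbertFactor r b (toℕ j)) ∎
      where
      x h : Vector Carrier n
      x j = ι (suc (toℕ j)) * r (suc b ℕ.+ toℕ j)
      h j = hilbertFactor r (2 ℕ.+ b) (toℕ j)
      top : Vector Carrier (suc n)
      top j = r (b ℕ.+ toℕ j)
      N : Matrix n (suc n)
      N i zero    = 0#
      N i (suc j) = x i * (x j * r (2 ℕ.+ (b ℕ.+ (toℕ i ℕ.+ toℕ j))))
      cleared : ∀ i j → r (b ℕ.+ (suc (toℕ i) ℕ.+ toℕ j)) ≈
        N i j + (ι (suc b) * r (suc b ℕ.+ toℕ i)) * r (b ℕ.+ toℕ j)
      cleared i zero = begin
        r (b ℕ.+ suc (toℕ i ℕ.+ 0))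
          ≈⟨ reflexive (≡.cong r (≡.trans (ℕₚ.+-suc b _) (≡.cong (λ k → suc (b ℕ.+ k)) (ℕₚ.+-identityʳ (toℕ i))))) ⟩
        r (suc b ℕ.+ toℕ i)
          ≈⟨ trans (*-congʳ (r-recip b)) (*-identityˡ _) ⟨
        (ι (suc b) * r b) * r (suc b ℕ.+ toℕ i)
          ≈⟨ solve 3 (λ a p q → (a :* p) :* q := con 0 :+ (a :* q) :* p) refl (ι (suc b)) (r b) _ ⟩
        0# + (ι (suc b) * r (suc b ℕ.+ toℕ i)) * r b
          ≈⟨ +-congˡ (*-congˡ (reflexive (≡.cong r (ℕₚ.+-identityʳ b)))) ⟨
        0# + (ι (suc b) * r (suc b ℕ.+ toℕ i)) * r (b ℕ.+ 0) ∎
      cleared i (suc j) = begin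
        r (b ℕ.+ suc (toℕ i ℕ.+ suc (toℕ j)))
          ≈⟨ reflexive (≡.cong r (≡.trans (ℕₚ.+-suc b _) (≡.cong suc
               (≡.trans (≡.cong (b ℕ.+_) (ℕₚ.+-suc (toℕ i) (toℕ j))) (ℕₚ.+-suc b _))))) ⟩
        r (2 ℕ.+ (b ℕ.+ (toℕ i ℕ.+ toℕ j)))
          ≈⟨ schur-complement b (toℕ i) (toℕ j) ⟩
        N i (suc j) + (ι (suc b) * r (suc b ℕ.+ toℕ i)) * r (suc b ℕ.+ toℕ j)
          ≈⟨ +-congˡ (*-congˡ (reflexive (≡.cong r (ℕₚ.+-suc b (toℕ j))))) ⟨
        N i (suc j) + (ι (suc b) * r (suc b ℕ.+ toℕ i)) * r (b ℕ.+ suc (toℕ j)) ∎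

    -- The pivot is (j! (b+j)!)² / ((b+2j)! (b+2j+1)!), stated without division. Replacing (b, j+1)
    -- by (b+2, j) keeps b+2j, hence the denominator, so only the numerators have to be compared.
    ι-hilbertFactor : ∀ b j → ι ((b ℕ.+ 2 ℕ.* j) ! ℕ.* (suc (b ℕ.+ 2 ℕ.* j)) !) * hilbertFactor r b j ≈
      ι ((j ! ℕ.* j !) ℕ.* ((b ℕ.+ j) ! ℕ.* (b ℕ.+ j) !))
    ι-hilbertFactor b zero = begin
      ι ((b ℕ.+ 0) ! ℕ.* (suc (b ℕ.+ 0)) !) * r b
        ≡⟨ ≡.cong (λ k → ι (k ! ℕ.* (suc k) !) * r b) (ℕₚ.+-identityʳ b) ⟩
      ι (b ! ℕ.* (suc b ℕ.* b !)) * r b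
        ≈⟨ *-congʳ (trans (×1-homo-* (b !) _) (*-congˡ (×1-homo-* (suc b) (b !)))) ⟩
      (ι (b !) * (ι (suc b) * ι (b !))) * r b
        ≈⟨ solve 3 (λ f c r → (f :* (c :* f)) :* r := (c :* r) :* (f :* f)) refl (ι (b !)) (ι (suc b)) (r b) ⟩
      (ι (suc b) * r b) * (ι (b !) * ι (b !))
        ≈⟨ trans (*-congʳ (r-recip b)) (*-identityˡ _) ⟩
      ι (b !) * ι (b !)
        ≈⟨ ×1-homo-* (b !) (b !) ⟨
      ι (b ! ℕ.* b !)
        ≡⟨ ≡.cong ι (≡.trans (≡.cong (λ k → k ! ℕ.* k !) (≡.sym (ℕₚ.+-identityʳ b))) (≡.sym (ℕₚ.+-identityʳ _))) ⟩
      ι (1 ℕ.* ((b ℕ.+ 0) ! ℕ.* (b ℕ.+ 0) !)) ∎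
    ι-hilbertFactor b (suc j) = begin
      ι ((b ℕ.+ 2 ℕ.* suc j) ! ℕ.* (suc (b ℕ.+ 2 ℕ.* suc j)) !) * ((x * x) * h)
        ≡⟨ ≡.cong (λ k → ι (k ! ℕ.* (suc k) !) * ((x * x) * h))
             (ℕ-solve 2 (λ b j → b ⊕ ℕ-con 2 ⊗ (ℕ-con 1 ⊕ j) ⊜ ℕ-con 2 ⊕ b ⊕ ℕ-con 2 ⊗ j) ≡.refl b j) ⟩
      D * ((x * x) * h)
        ≈⟨ solve 3 (λ d x h → d :* ((x :* x) :* h) := (x :* x) :* (d :* h)) refl D x h ⟩
      (x * x) * (D * h)
        ≈⟨ *-congˡ (trans (ι-hilbertFactor (2 ℕ.+ b) j) (ι-squares (j !) ((2 ℕ.+ b ℕ.+ j) !))) ⟩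
      (x * x) * ((f * f) * (g′ * g′))
        ≈⟨ solve 3 (λ x f g → (x :* x) :* ((f :* f) :* (g :* g)) := (f :* (x :* g)) :* (f :* (x :* g))) refl x f g′ ⟩
      (f * (x * g′)) * (f * (x * g′))
        ≈⟨ *-cong shrink shrink ⟩
      (f * (J * g)) * (f * (J * g))
        ≈⟨ solve 3 (λ f j g → (f :* (j :* g)) :* (f :* (j :* g)) := ((j :* f) :* (j :* f)) :* (g :* g)) refl f J g ⟩
      ((J * f) * (J * f)) * (g * g)
        ≈⟨ *-congʳ (*-cong (×1-homo-* (suc j) (j !)) (×1-homo-* (suc j) (j !))) ⟨
      (ι (suc j !) * ι (suc j !)) * (g * g)
        ≈⟨ ι-squares (suc j !) (suc (b ℕ.+ j) !) ⟨
      ι ((suc j ! ℕ.* suc j !) ℕ.* (suc (b ℕ.+ j) ! ℕ.* suc (b ℕ.+ j) !))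
        ≡⟨ ≡.cong (λ k → ι ((suc j ! ℕ.* suc j !) ℕ.* (k ! ℕ.* k !))) (ℕₚ.+-suc b j) ⟨
      ι ((suc j ! ℕ.* suc j !) ℕ.* ((b ℕ.+ suc j) ! ℕ.* (b ℕ.+ suc j) !)) ∎
      where
      J x f g g′ h D : Carrier
      J = ι (suc j)
      x = J * r (suc b ℕ.+ j)
      f = ι (j !)
      g = ι (suc (b ℕ.+ j) !)
      g′ = ι ((2 ℕ.+ b ℕ.+ j) !)
      h = hilbertFactor r (2 ℕ.+ b) j
      D = ι ((2 ℕ.+ b ℕ.+ 2 ℕ.* j) ! ℕ.* (suc (2 ℕ.+ b ℕ.+ 2 ℕ.* j)) !)
      ι-squares : ∀ m n → ι ((m ℕ.* m) ℕ.* (n ℕ.* n)) ≈ (ι m * ι m) * (ι n * ι n)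
      ι-squares m n = trans (×1-homo-* (m ℕ.* m) (n ℕ.* n)) (*-cong (×1-homo-* m m) (×1-homo-* n n))
      shrink : f * (x * g′) ≈ f * (J * g)
      shrink = *-congˡ (begin
        (J * r (suc b ℕ.+ j)) * g′
          ≈⟨ *-congˡ (×1-homo-* (2 ℕ.+ b ℕ.+ j) (suc (b ℕ.+ j) !)) ⟩
        (J * r (suc b ℕ.+ j)) * (ι (2 ℕ.+ b ℕ.+ j) * g)
          ≈⟨ solve 4 (λ j r c g → (j :* r) :* (c :* g) := (c :* r) :* (j :* g)) refl J _ _ g ⟩
        (ι (2 ℕ.+ b ℕ.+ j) * r (suc b ℕ.+ j)) * (J * g)
          ≈⟨ trans (*-congʳ (r-recip _)) (*-identityˡ _) ⟩
        J * g ∎)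

  -- Moments of the Bernoulli functional

  newton-head : ∀ v i s → newton shift v (suc i) s ≐ newton shift (v ∘ suc) i ((v 0 ⊹ shift) s)
  newton-head v zero    s m = refl
  newton-head v (suc i) s m = Linear.cong (⊹-linear shift-linear (v (suc i))) (newton-head v i s) m

  newton-cong-seq : ∀ v i {s t} → s ≐ t → newton shift v i s ≐ newton shift v i t
  newton-cong-seq v i = Linear.cong (newton-linear shift-linear v i)

  newton-shift : ∀ v i s → newton shift v i (shift s) ≐ shift (newton shift v i s)
  newton-shift = newton-comm shift-linear shift-linear (λ _ _ → refl)

  ⊹-zero : ∀ {v} → v ≈ 0# → ∀ s → (v ⊹ shift) s ≐ shift s
  ⊹-zero v≈0 s m = trans (+-congʳ (trans (*-congʳ v≈0) (zeroˡ _))) (+-identityˡ _)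

  -- Since z + w = (z + 1) + v, raising all nodes by one is the substitution of z + 1 for z.
  newton-1⊹shift : ∀ {v w} → (∀ k → w k ≈ v k + 1#) → ∀ i s →
    newton shift w i s ≐ newton (1# ⊹ shift) v i s
  newton-1⊹shift         w≈v+1 zero    s m = refl
  newton-1⊹shift {v} {w} w≈v+1 (suc i) s m = begin
    w i * t m + t (suc m)                ≈⟨ +-congʳ (*-congʳ (w≈v+1 i)) ⟩
    (v i + 1#) * t m + t (suc m)         ≈⟨ solve 4 (λ v o a b → (v :+ o) :* a :+ b := v :* a :+ (o :* a :+ b))
                                              refl (v i) 1# (t m) (t (suc m)) ⟩
    (v i ⊹ (1# ⊹ shift)) t m             ≈⟨ Linear.cong (⊹-linear (⊹-linear shift-linear 1#) (v i))
                                              (newton-1⊹shift w≈v+1 i s) m ⟩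
    (v i ⊹ (1# ⊹ shift)) (newton (1# ⊹ shift) v i s) m ∎
    where
    t : Seq
    t = newton shift w i s

  δ : Seq
  δ zero    = 1#
  δ (suc m) = 0#

  -- δ′ represents the functional p ↦ p′(0).
  δ′ : Seq
  δ′ zero    = 0#
  δ′ (suc m) = δ m

  nodeProduct : (ℕ → Carrier) → ℕ → Carrier
  nodeProduct v zero    = 1#
  nodeProduct v (suc i) = v i * nodeProduct v i

  -- Evaluation at 0 is multiplicative, so multiplying by a polynomial only scales it, by the value
  -- of that polynomial at 0.
  newton-δ : ∀ v i a m → newton shift v i (λ m → a * δ m) m ≈ (nodeProduct v i * a) * δ m
  newton-δ v zero    a m = *-congʳ (sym (*-identityˡ a))
  newton-δ v (suc i) a m = begin
    v i * newton shift v i (λ m → a * δ m) m + newton shift v i (λ m → a * δ m) (suc m)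
      ≈⟨ +-cong (*-congˡ (newton-δ v i a m)) (trans (newton-δ v i a (suc m)) (zeroʳ _)) ⟩
    v i * ((nodeProduct v i * a) * δ m) + 0#
      ≈⟨ solve 4 (λ v p a d → v :* ((p :* a) :* d) :+ con 0 := ((v :* p) :* a) :* d) refl
           (v i) (nodeProduct v i) a (δ m) ⟩
    (nodeProduct v (suc i) * a) * δ m ∎

  raisingNodes fallingNodes : ℕ → Carrier
  raisingNodes k = ι (suc k)
  fallingNodes k = - ι k

  nodeProduct-raisingNodes : ∀ i → nodeProduct raisingNodes i ≈ ι (i !)
  nodeProduct-raisingNodes zero    = sym (+-identityʳ 1#)
  nodeProduct-raisingNodes (suc i) = trans (*-congˡ (nodeProduct-raisingNodes i)) (sym (×1-homo-* (suc i) (i !)))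

  nodeProduct-fallingNodes : ∀ j → nodeProduct (fallingNodes ∘ suc) j ≈ sgn j * ι (j !)
  nodeProduct-fallingNodes zero    = sym (trans (*-identityˡ _) (+-identityʳ 1#))
  nodeProduct-fallingNodes (suc j) = begin
    - ι (suc j) * nodeProduct (fallingNodes ∘ suc) j  ≈⟨ *-congˡ (nodeProduct-fallingNodes j) ⟩
    - ι (suc j) * (sgn j * ι (j !))               ≈⟨ -‿distribˡ-* _ _ ⟨
    - (ι (suc j) * (sgn j * ι (j !)))             ≈⟨ -‿cong (solve 3 (λ a s f → a :* (s :* f) := s :* (a :* f)) refl _ _ _) ⟩
    - (sgn j * (ι (suc j) * ι (j !)))             ≈⟨ -‿cong (*-congˡ (×1-homo-* (suc j) (j !))) ⟨
    - (sgn j * ι (suc j !))                       ≈⟨ -‿distribˡ-* _ _ ⟩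
    - sgn j * ι (suc j !)                         ∎

  -- The umbral form of L[p(z + 1)] = L[p(z)] + p′(0).
  IsBernoulli : Seq → Set ℓ
  IsBernoulli s = orbit (⊹-linear shift-linear 1#) s ≐ λ k → s k + δ′ k

  module _ {s : Seq} (bernoulli : IsBernoulli s) where

    moment : ℕ → ℕ → Carrier
    moment i j = newton shift raisingNodes i (newton shift fallingNodes j s) 0

    -- Split the new factor as z + i + 1 = (i + j + 1) + (z - j): the second part turns g_j into
    -- g_{j+1}.
    moment-suc : ∀ i j →
      newton shift raisingNodes (suc i) (newton shift fallingNodes j s) 0 ≈
      ι (suc (i ℕ.+ j)) * moment i j + moment i (suc j)
    moment-suc i j = sym (begin
      ι (suc i ℕ.+ j) * M + F (newton shift fallingNodes (suc j) s) 0
        ≈⟨ +-cong (*-congʳ (×-homo-+ 1# (suc i) j))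
             (trans (Linear.linear (newton-linear shift-linear raisingNodes i) (- ι j) u (shift u) 0)
               (+-congˡ (newton-shift raisingNodes i u 0))) ⟩
      (ι (suc i) + ι j) * M + (- ι j * M + F u 1)
        ≈⟨ solve 5 (λ a b c m f → (a :+ b) :* m :+ (c :* m :+ f) := (a :* m :+ f) :+ (b :+ c) :* m) refl
             (ι (suc i)) (ι j) (- ι j) M (F u 1) ⟩
      (ι (suc i) * M + F u 1) + (ι j + - ι j) * M
        ≈⟨ +-congˡ (trans (*-congʳ (-‿inverseʳ (ι j))) (zeroˡ M)) ⟩
      (ι (suc i) * M + F u 1) + 0#
        ≈⟨ +-identityʳ _ ⟩
      ι (suc i) * M + F u 1 ∎)
      where
      F : Seq → Seq
      F = newton shift raisingNodes i
      u : Seq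
      u = newton shift fallingNodes j s
      M : Carrier
      M = moment i j

    -- The functional `t` at p = z(z+1)...(z+i) · (z-1)...(z-j). The root 0 is the first node of
    -- `ι`, where `newton-head` can detach it.
    translated : ℕ → ℕ → Seq → Carrier
    translated i j t = newton shift ι (suc i) (newton shift (fallingNodes ∘ suc) j t) 0

    -- Every node of f_{i+1} g_j exceeds a node of p by one, so this product is p(z + 1), and the
    -- Bernoulli property applies.
    moment-translate : ∀ i j →
      newton shift raisingNodes (suc i) (newton shift fallingNodes j s) 0 ≈ translated i j s + translated i j δ′
    moment-translate i j = begin
      newton shift raisingNodes (suc i) (newton shift fallingNodes j s) 0
        ≈⟨ newton-cong-seq raisingNodes (suc i) (newton-1⊹shift fallingNodes-suc j s) 0 ⟩
      newton shift raisingNodes (suc i) (newton A w j s) 0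
        ≈⟨ newton-1⊹shift (λ k → +-comm 1# (ι k)) (suc i) (newton A w j s) 0 ⟩
      newton A ι (suc i) (newton A w j s) 0
        ≈⟨ newton-orbit lin ι (suc i) (newton A w j s) 0 ⟨
      newton shift ι (suc i) (orbit lin (newton A w j s)) 0
        ≈⟨ newton-cong-seq ι (suc i) (newton-orbit lin w j s) 0 ⟨
      translated i j (orbit lin s)
        ≈⟨ translated-cong (λ k → trans (bernoulli k) (+-congʳ (sym (*-identityˡ _)))) ⟩
      translated i j (λ k → 1# * s k + δ′ k)
        ≈⟨ newton-cong-seq ι (suc i) (Linear.linear (newton-linear shift-linear w j) 1# s δ′) 0 ⟩
      newton shift ι (suc i) (λ k → 1# * newton shift w j s k + newton shift w j δ′ k) 0
        ≈⟨ Linear.linear (newton-linear shift-linear ι (suc i)) 1# _ _ 0 ⟩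
      1# * translated i j s + translated i j δ′
        ≈⟨ +-congʳ (*-identityˡ _) ⟩
      translated i j s + translated i j δ′ ∎
      where
      w : ℕ → Carrier
      w = fallingNodes ∘ suc
      A : Seq → Seq
      A = 1# ⊹ shift
      lin : Linear A
      lin = ⊹-linear shift-linear 1#
      translated-cong : ∀ {t u} → t ≐ u → translated i j t ≈ translated i j u
      translated-cong t≐u = newton-cong-seq ι (suc i) (newton-cong-seq w j t≐u) 0
      fallingNodes-suc : ∀ k → fallingNodes k ≈ w k + 1#
      fallingNodes-suc k = sym (begin
        - (1# + ι k) + 1#      ≈⟨ +-congʳ (-‿+-comm 1# (ι k)) ⟨
        (- 1# + - ι k) + 1#    ≈⟨ solve 3 (λ a b c → (a :+ b) :+ c := b :+ (a :+ c)) refl (- 1#) (- ι k) 1# ⟩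
        - ι k + (- 1# + 1#)    ≈⟨ +-congˡ (-‿inverseˡ 1#) ⟩
        - ι k + 0#             ≈⟨ +-identityʳ _ ⟩
        - ι k                  ∎)

    translated-shift : ∀ i j t → translated i j t ≈ newton shift raisingNodes i (newton shift (fallingNodes ∘ suc) j (shift t)) 0
    translated-shift i j t = trans (newton-head ι i _ 0) (newton-cong-seq raisingNodes i
      (λ m → trans (⊹-zero refl (newton shift (fallingNodes ∘ suc) j t) m) (sym (newton-shift (fallingNodes ∘ suc) j t m))) 0)

    translated-s : ∀ i j → translated i j s ≈ moment i (suc j)
    translated-s i j = trans (translated-shift i j s) (newton-cong-seq raisingNodes i (λ m → sym (trans
      (newton-head fallingNodes j s m)
      (newton-cong-seq (fallingNodes ∘ suc) j (⊹-zero -0#≈0# s) m))) 0)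

    -- As z is a factor of p, the derivative p′(0) is the value at 0 of p/z = (z+1)...(z+i) ·
    -- (z-1)...(z-j).
    translated-δ′ : ∀ i j → translated i j δ′ ≈ ι (i !) * (sgn j * ι (j !))
    translated-δ′ i j = begin
      translated i j δ′
        ≈⟨ translated-shift i j δ′ ⟩
      newton shift raisingNodes i (newton shift w j δ) 0
        ≈⟨ newton-cong-seq raisingNodes i (λ m → trans
             (newton-cong-seq w j (λ m → sym (*-identityˡ _)) m) (newton-δ w j 1# m)) 0 ⟩
      newton shift raisingNodes i (λ m → (nodeProduct w j * 1#) * δ m) 0
        ≈⟨ newton-δ raisingNodes i _ 0 ⟩
      (nodeProduct raisingNodes i * (nodeProduct w j * 1#)) * 1#
        ≈⟨ trans (*-identityʳ _) (*-congˡ (*-identityʳ _)) ⟩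
      nodeProduct raisingNodes i * nodeProduct w j
        ≈⟨ *-cong (nodeProduct-raisingNodes i) (nodeProduct-fallingNodes j) ⟩
      ι (i !) * (sgn j * ι (j !)) ∎
      where
      w : ℕ → Carrier
      w = fallingNodes ∘ suc

    -- L[f_{i+1} g_j] is known in two ways, by splitting a factor and by translation. Both contain
    -- L[f_i g_{j+1}], because p = f_i g_{j+1}; cancelling it leaves p′(0).
    ι-moment : ∀ i j → ι (suc (i ℕ.+ j)) * moment i j ≈ ι (i !) * (sgn j * ι (j !))
    ι-moment i j = +-cancelʳ (moment i (suc j)) _ _ (begin
      ι (suc (i ℕ.+ j)) * moment i j + moment i (suc j)  ≈⟨ moment-suc i j ⟨
      _                                                  ≈⟨ moment-translate i j ⟩
      translated i j s + translated i j δ′                                 ≈⟨ +-cong (translated-s i j) (translated-δ′ i j) ⟩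
      moment i (suc j) + ι (i !) * (sgn j * ι (j !))     ≈⟨ +-comm _ _ ⟩
      ι (i !) * (sgn j * ι (j !)) + moment i (suc j)     ∎)

    module _ {r : ℕ → Carrier} (r-recip : IsReciprocal r) where

      moment≈ : ∀ i j → moment i j ≈ ι (i !) * ((sgn j * ι (j !)) * r (i ℕ.+ j))
      moment≈ i j = begin
        moment i j                                       ≈⟨ trans (*-congʳ (r-recip (i ℕ.+ j))) (*-identityˡ _) ⟨
        (ι (suc (i ℕ.+ j)) * r (i ℕ.+ j)) * moment i j   ≈⟨ solve 3 (λ a r m → (a :* r) :* m := (a :* m) :* r) refl _ _ _ ⟩
        (ι (suc (i ℕ.+ j)) * moment i j) * r (i ℕ.+ j)   ≈⟨ *-congʳ (ι-moment i j) ⟩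
        (ι (i !) * (sgn j * ι (j !))) * r (i ℕ.+ j)      ≈⟨ *-assoc _ _ _ ⟩
        ι (i !) * ((sgn j * ι (j !)) * r (i ℕ.+ j))      ∎

      det-bernoulli : ∀ n → det n (λ i j → s (toℕ i ℕ.+ toℕ j)) ≈
        ∏ {n} (λ k → (ι (toℕ k !) * (sgn (toℕ k) * ι (toℕ k !))) * hilbertFactor r 0 (toℕ k))
      det-bernoulli n = begin
        det n (λ i j → s (toℕ i ℕ.+ toℕ j))
          ≈⟨ det-newton n raisingNodes fallingNodes s ⟨
        det n (λ i j → moment (toℕ i) (toℕ j))
          ≈⟨ det-cong n (λ i j → moment≈ (toℕ i) (toℕ j)) ⟩
        det n (λ i j → x i * (y j * r (toℕ i ℕ.+ toℕ j)))
          ≈⟨ trans (det-scale-rows n x _) (*-congˡ (det-scale-columns n y _)) ⟩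
        ∏ x * (∏ y * det n (λ i j → r (toℕ i ℕ.+ toℕ j)))
          ≈⟨ *-congˡ (*-congˡ (det-hilbert r-recip n 0)) ⟩
        ∏ x * (∏ y * ∏ h)
          ≈⟨ trans (sym (*-assoc _ _ _)) (trans (*-congʳ (sym (∏-* x y))) (sym (∏-* _ h))) ⟩
        ∏ (λ k → (x k * y k) * h k) ∎
        where
        x y h : Vector Carrier n
        x k = ι (toℕ k !)
        y k = sgn (toℕ k) * ι (toℕ k !)
        h k = hilbertFactor r 0 (toℕ k)

-- Polynomials

open import Defs
open import Data.List using ([]; _∷_)
open import Data.Nat using (_*_; _<_)
open import Data.Rational using (-_)
open ≡ using (refl; sym; trans; cong; cong₂)
open ℚ-Solver using (solve; _:=_; _:+_; _:*_; :-_; con)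

infix 4 _≋_
-- Lists that differ by trailing zeros must count as equal. The record wrapper lets `p` and `q` be
-- inferred from a proof.
record _≋_ (p q : Poly) : Set where
  constructor pointwise
  field at : ∀ m → coeff p m ≡ coeff q m
open _≋_

≋-refl : ∀ {p} → p ≋ p
≋-refl .at m = refl

≋-sym : ∀ {p q} → p ≋ q → q ≋ p
≋-sym p≋q .at m = sym (p≋q .at m)

≋-trans : ∀ {p q r} → p ≋ q → q ≋ r → p ≋ r
≋-trans p≋q q≋r .at m = trans (p≋q .at m) (q≋r .at m)

≋-setoid : Setoid 0ℓ 0ℓ
≋-setoid = record
  { _≈_ = _≋_ ; isEquivalence = record { refl = ≋-refl ; sym = ≋-sym ; trans = ≋-trans } }

module ≋-Reasoning where
  open import Relation.Binary.Reasoning.Setoid ≋-setoid public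

coeff-+ₚ : ∀ p q m → coeff (p +ₚ q) m ≡ coeff p m ℚ.+ coeff q m
coeff-+ₚ []      q       m       = sym (ℚₚ.+-identityˡ _)
coeff-+ₚ (a ∷ p) []      m       = sym (ℚₚ.+-identityʳ _)
coeff-+ₚ (a ∷ p) (b ∷ q) zero    = refl
coeff-+ₚ (a ∷ p) (b ∷ q) (suc m) = coeff-+ₚ p q m

coeff-·ₚ : ∀ c p m → coeff (c ·ₚ p) m ≡ c ℚ.* coeff p m
coeff-·ₚ c []      m       = sym (ℚₚ.*-zeroʳ c)
coeff-·ₚ c (a ∷ p) zero    = refl
coeff-·ₚ c (a ∷ p) (suc m) = coeff-·ₚ c p m

coeff-lin : ∀ a p q m → coeff (a ·ₚ p +ₚ q) m ≡ a ℚ.* coeff p m ℚ.+ coeff q m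
coeff-lin a p q m = trans (coeff-+ₚ (a ·ₚ p) q m) (cong (ℚ._+ coeff q m) (coeff-·ₚ a p m))

+ₚ-cong : ∀ {p p′ q q′} → p ≋ p′ → q ≋ q′ → p +ₚ q ≋ p′ +ₚ q′
+ₚ-cong {p} {p′} {q} {q′} p≋p′ q≋q′ .at m = trans (coeff-+ₚ p q m) (trans
  (cong₂ ℚ._+_ (p≋p′ .at m) (q≋q′ .at m)) (sym (coeff-+ₚ p′ q′ m)))

+ₚ-assoc : ∀ p q r → (p +ₚ q) +ₚ r ≋ p +ₚ (q +ₚ r)
+ₚ-assoc p q r .at m
  rewrite coeff-+ₚ (p +ₚ q) r m | coeff-+ₚ p q m | coeff-+ₚ p (q +ₚ r) m | coeff-+ₚ q r m = ℚₚ.+-assoc (coeff p m) (coeff q m) (coeff r m)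

+ₚ-comm : ∀ p q → p +ₚ q ≋ q +ₚ p
+ₚ-comm p q .at m rewrite coeff-+ₚ p q m | coeff-+ₚ q p m = ℚₚ.+-comm (coeff p m) (coeff q m)

+ₚ-identityʳ : ∀ p → p +ₚ [] ≋ p
+ₚ-identityʳ p .at m = trans (coeff-+ₚ p [] m) (ℚₚ.+-identityʳ _)

·ₚ-cong : ∀ c {p q} → p ≋ q → c ·ₚ p ≋ c ·ₚ q
·ₚ-cong c {p} {q} p≋q .at m = trans (coeff-·ₚ c p m) (trans (cong (c ℚ.*_) (p≋q .at m)) (sym (coeff-·ₚ c q m)))

∷-cong : ∀ {a b p q} → a ≡ b → p ≋ q → a ∷ p ≋ b ∷ q
∷-cong a≡b p≋q .at zero    = a≡b
∷-cong a≡b p≋q .at (suc m) = p≋q .at m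

0∷[] : 0ℚ ∷ [] ≋ []
0∷[] .at zero    = refl
0∷[] .at (suc m) = refl

infix 8 -ₚ_
-ₚ_ : Poly → Poly
-ₚ p = (- 1ℚ) ·ₚ p

+ₚ-inverseʳ : ∀ p → p +ₚ -ₚ p ≋ []
+ₚ-inverseʳ p .at m rewrite coeff-+ₚ p (-ₚ p) m | coeff-·ₚ (- 1ℚ) p m =
  trans (cong (coeff p m ℚ.+_) (trans (sym (ℚₚ.neg-distribˡ-* 1ℚ (coeff p m))) (cong -_ (ℚₚ.*-identityˡ (coeff p m)))))
    (ℚₚ.+-inverseʳ (coeff p m))

*ₚ-congˡ : ∀ p {q q′} → q ≋ q′ → p *ₚ q ≋ p *ₚ q′
*ₚ-congˡ []      q≋q′ = ≋-refl
*ₚ-congˡ (a ∷ p) q≋q′ = +ₚ-cong (·ₚ-cong a q≋q′) (∷-cong refl (*ₚ-congˡ p q≋q′))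

*ₚ-zeroʳ : ∀ p → p *ₚ [] ≋ []
*ₚ-zeroʳ []      = ≋-refl
*ₚ-zeroʳ (a ∷ p) = ≋-trans (∷-cong refl (*ₚ-zeroʳ p)) 0∷[]

-- The defining recursion of the product, mirrored to its right factor; commutativity follows by
-- comparing the two.
*ₚ-∷ʳ : ∀ p b q → p *ₚ (b ∷ q) ≋ b ·ₚ p +ₚ (0ℚ ∷ p *ₚ q)
*ₚ-∷ʳ []      b q = ≋-sym 0∷[]
*ₚ-∷ʳ (a ∷ p) b q = ∷-cong
  (cong (ℚ._+ 0ℚ) (ℚₚ.*-comm a b))
  (≋-trans (+ₚ-cong ≋-refl (*ₚ-∷ʳ p b q)) (pointwise λ m → begin
    coeff (a ·ₚ q +ₚ (b ·ₚ p +ₚ (0ℚ ∷ p *ₚ q))) m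
      ≡⟨ trans (coeff-lin a q _ m) (cong (a ℚ.* coeff q m ℚ.+_) (coeff-lin b p _ m)) ⟩
    a ℚ.* coeff q m ℚ.+ (b ℚ.* coeff p m ℚ.+ coeff (0ℚ ∷ p *ₚ q) m)
      ≡⟨ solve 3 (λ x y z → x :+ (y :+ z) := y :+ (x :+ z)) refl (a ℚ.* coeff q m) (b ℚ.* coeff p m) (coeff (0ℚ ∷ p *ₚ q) m) ⟩
    b ℚ.* coeff p m ℚ.+ (a ℚ.* coeff q m ℚ.+ coeff (0ℚ ∷ p *ₚ q) m)
      ≡⟨ trans (coeff-lin b p _ m) (cong (b ℚ.* coeff p m ℚ.+_) (coeff-lin a q _ m)) ⟨
    coeff (b ·ₚ p +ₚ (a ·ₚ q +ₚ (0ℚ ∷ p *ₚ q))) m ∎))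
  where open ≡.≡-Reasoning

*ₚ-comm : ∀ p q → p *ₚ q ≋ q *ₚ p
*ₚ-comm []      q = ≋-sym (*ₚ-zeroʳ q)
*ₚ-comm (a ∷ p) q = ≋-trans (+ₚ-cong ≋-refl (∷-cong refl (*ₚ-comm p q))) (≋-sym (*ₚ-∷ʳ q a p))

*ₚ-cong : ∀ {p p′ q q′} → p ≋ p′ → q ≋ q′ → p *ₚ q ≋ p′ *ₚ q′
*ₚ-cong {p} {p′} {q} {q′} p≋p′ q≋q′ = begin
  p *ₚ q   ≈⟨ *ₚ-congˡ p q≋q′ ⟩
  p *ₚ q′  ≈⟨ *ₚ-comm p q′ ⟩
  q′ *ₚ p  ≈⟨ *ₚ-congˡ q′ p≋p′ ⟩
  q′ *ₚ p′ ≈⟨ *ₚ-comm q′ p′ ⟩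
  p′ *ₚ q′ ∎
  where open ≋-Reasoning

*ₚ-distribˡ : ∀ p q r → p *ₚ (q +ₚ r) ≋ p *ₚ q +ₚ p *ₚ r
*ₚ-distribˡ []      q r = ≋-refl
*ₚ-distribˡ (a ∷ p) q r = ≋-trans (+ₚ-cong ≋-refl (∷-cong (sym (ℚₚ.+-identityʳ 0ℚ)) (*ₚ-distribˡ p q r)))
  (pointwise λ m → begin
    coeff (a ·ₚ (q +ₚ r) +ₚ ((0ℚ ∷ p *ₚ q) +ₚ (0ℚ ∷ p *ₚ r))) m
      ≡⟨ trans (coeff-lin a (q +ₚ r) _ m) (cong₂ (λ x y → a ℚ.* x ℚ.+ y) (coeff-+ₚ q r m)
           (coeff-+ₚ (0ℚ ∷ p *ₚ q) (0ℚ ∷ p *ₚ r) m)) ⟩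
    a ℚ.* (coeff q m ℚ.+ coeff r m) ℚ.+ (coeff (0ℚ ∷ p *ₚ q) m ℚ.+ coeff (0ℚ ∷ p *ₚ r) m)
      ≡⟨ solve 5 (λ a q r x y → a :* (q :+ r) :+ (x :+ y) := (a :* q :+ x) :+ (a :* r :+ y)) refl
           a (coeff q m) (coeff r m) (coeff (0ℚ ∷ p *ₚ q) m) (coeff (0ℚ ∷ p *ₚ r) m) ⟩
    (a ℚ.* coeff q m ℚ.+ coeff (0ℚ ∷ p *ₚ q) m) ℚ.+ (a ℚ.* coeff r m ℚ.+ coeff (0ℚ ∷ p *ₚ r) m)
      ≡⟨ trans (coeff-+ₚ ((a ∷ p) *ₚ q) _ m) (cong₂ ℚ._+_ (coeff-lin a q _ m) (coeff-lin a r _ m)) ⟨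
    coeff ((a ∷ p) *ₚ q +ₚ (a ∷ p) *ₚ r) m ∎)
  where open ≡.≡-Reasoning

*ₚ-distribʳ : ∀ r p q → (p +ₚ q) *ₚ r ≋ p *ₚ r +ₚ q *ₚ r
*ₚ-distribʳ r p q = ≋-trans (*ₚ-comm (p +ₚ q) r) (≋-trans (*ₚ-distribˡ r p q)
  (+ₚ-cong (*ₚ-comm r p) (*ₚ-comm r q)))

·ₚ-*ₚ-assoc : ∀ a p q → (a ·ₚ p) *ₚ q ≋ a ·ₚ (p *ₚ q)
·ₚ-*ₚ-assoc a []      q = ≋-refl
·ₚ-*ₚ-assoc a (b ∷ p) q = ≋-trans (+ₚ-cong ≋-refl (∷-cong (sym (ℚₚ.*-zeroʳ a)) (·ₚ-*ₚ-assoc a p q)))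
  (pointwise λ m → begin
    coeff ((a ℚ.* b) ·ₚ q +ₚ a ·ₚ (0ℚ ∷ p *ₚ q)) m
      ≡⟨ trans (coeff-lin (a ℚ.* b) q _ m) (cong (a ℚ.* b ℚ.* coeff q m ℚ.+_) (coeff-·ₚ a (0ℚ ∷ p *ₚ q) m)) ⟩
    a ℚ.* b ℚ.* coeff q m ℚ.+ a ℚ.* coeff (0ℚ ∷ p *ₚ q) m
      ≡⟨ solve 4 (λ a b x y → a :* b :* x :+ a :* y := a :* (b :* x :+ y)) refl
           a b (coeff q m) (coeff (0ℚ ∷ p *ₚ q) m) ⟩
    a ℚ.* (b ℚ.* coeff q m ℚ.+ coeff (0ℚ ∷ p *ₚ q) m)
      ≡⟨ trans (coeff-·ₚ a ((b ∷ p) *ₚ q) m) (cong (a ℚ.*_) (coeff-lin b q _ m)) ⟨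
    coeff (a ·ₚ ((b ∷ p) *ₚ q)) m ∎)
  where open ≡.≡-Reasoning

0·ₚ : ∀ p → 0ℚ ·ₚ p ≋ []
0·ₚ p .at m = trans (coeff-·ₚ 0ℚ p m) (ℚₚ.*-zeroˡ (coeff p m))

*ₚ-assoc : ∀ p q r → (p *ₚ q) *ₚ r ≋ p *ₚ (q *ₚ r)
*ₚ-assoc []      q r = ≋-refl
*ₚ-assoc (a ∷ p) q r = ≋-trans (*ₚ-distribʳ r (a ·ₚ q) (0ℚ ∷ p *ₚ q))
  (+ₚ-cong (·ₚ-*ₚ-assoc a q r)
    (≋-trans (+ₚ-cong (0·ₚ r) ≋-refl) (∷-cong refl (*ₚ-assoc p q r))))

constₚ-*ₚ : ∀ c p → constₚ c *ₚ p ≋ c ·ₚ p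
constₚ-*ₚ c p = ≋-trans (+ₚ-cong ≋-refl 0∷[]) (+ₚ-identityʳ (c ·ₚ p))

*ₚ-identityˡ : ∀ p → constₚ 1ℚ *ₚ p ≋ p
*ₚ-identityˡ p = ≋-trans (constₚ-*ₚ 1ℚ p) (pointwise λ m → trans (coeff-·ₚ 1ℚ p m) (ℚₚ.*-identityˡ (coeff p m)))

polyRing : CommutativeRing 0ℓ 0ℓ
polyRing = record
  { Carrier = Poly ; _≈_ = _≋_ ; _+_ = _+ₚ_ ; _*_ = _*ₚ_ ; -_ = -ₚ_ ; 0# = [] ; 1# = constₚ 1ℚ
  ; isCommutativeRing = record
    { isRing = record
      { +-isAbelianGroup = record
        { isGroup = record
          { isMonoid = record
            { isSemigroup = record
              { isMagma = record { isEquivalence = Setoid.isEquivalence ≋-setoid ; ∙-cong = +ₚ-cong }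
              ; assoc = +ₚ-assoc
              }
            ; identity = (λ p → ≋-refl) , +ₚ-identityʳ
            }
          ; inverse = (λ p → ≋-trans (+ₚ-comm (-ₚ p) p) (+ₚ-inverseʳ p)) , +ₚ-inverseʳ
          ; ⁻¹-cong = ·ₚ-cong (- 1ℚ)
          }
        ; comm = +ₚ-comm
        }
      ; *-cong = *ₚ-cong
      ; *-assoc = *ₚ-assoc
      ; *-identity = *ₚ-identityˡ , λ p → ≋-trans (*ₚ-comm p (constₚ 1ℚ)) (*ₚ-identityˡ p)
      ; distrib = *ₚ-distribˡ , *ₚ-distribʳ
      }
    ; *-comm = *ₚ-comm
    }
  }

module P where
  open Determinant polyRing public
  open Sequences polyRing public

module Q = Determinant ℚₚ.+-*-commutativeRing

-- The coefficient t of x^d may vanish: d only bounds the degree.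
record HasTop (p : Poly) (d : ℕ) (t : ℚ) : Set where
  field
    above : ∀ {m} → d ℕ.< m → coeff p m ≡ 0ℚ
    top   : coeff p d ≡ t
open HasTop

HasTop-≋ : ∀ {p q d t} → p ≋ q → HasTop q d t → HasTop p d t
HasTop-≋ p≋q q .above d<m = trans (p≋q .at _) (q .above d<m)
HasTop-≋ p≋q q .top       = trans (p≋q .at _) (q .top)

HasTop-[] : ∀ d → HasTop [] d 0ℚ
HasTop-[] d .above _ = refl
HasTop-[] d .top     = refl

HasTop-raise : ∀ {p d t} → HasTop p d t → HasTop p (suc d) 0ℚ
HasTop-raise p .above d<m = p .above (ℕₚ.<-trans (ℕₚ.n<1+n _) d<m)
HasTop-raise p .top       = p .above (ℕₚ.n<1+n _)

HasTop-+ : ∀ {p q d t u} → HasTop p d t → HasTop q d u → HasTop (p +ₚ q) d (t ℚ.+ u)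
HasTop-+ {p} {q} hp hq .above {m} d<m = trans (coeff-+ₚ p q m)
  (cong₂ ℚ._+_ (hp .above d<m) (hq .above d<m))
HasTop-+ {p} {q} {d} hp hq .top = trans (coeff-+ₚ p q d) (cong₂ ℚ._+_ (hp .top) (hq .top))

HasTop-·ₚ : ∀ c {p d t} → HasTop p d t → HasTop (c ·ₚ p) d (c ℚ.* t)
HasTop-·ₚ c {p} h .above d<m = trans (coeff-·ₚ c p _) (trans (cong (c ℚ.*_) (h .above d<m)) (ℚₚ.*-zeroʳ c))
HasTop-·ₚ c {p} h .top       = trans (coeff-·ₚ c p _) (cong (c ℚ.*_) (h .top))

HasTop-≡ : ∀ {p d e t u} → d ≡ e → t ≡ u → HasTop p d t → HasTop p e u
HasTop-≡ refl refl h = h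

HasTop-0∷ : ∀ {p d t} → HasTop p d t → HasTop (0ℚ ∷ p) (suc d) t
HasTop-0∷ h .above {suc m} d<m = h .above (ℕ.s<s⁻¹ d<m)
HasTop-0∷ h .top = h .top

HasTop-raiseBy : ∀ k {p d t} → HasTop p d t → HasTop p (suc k ℕ.+ d) 0ℚ
HasTop-raiseBy zero    h = HasTop-raise h
HasTop-raiseBy (suc k) h = HasTop-raise (HasTop-raiseBy k h)

HasTop-* : ∀ {p q d e t u} → HasTop p d t → HasTop q e u → HasTop (p *ₚ q) (d ℕ.+ e) (t ℚ.* u)
HasTop-* {[]} {u = u} hp hq = HasTop-≡ refl
  (trans (sym (ℚₚ.*-zeroˡ u)) (cong (ℚ._* u) (hp .top))) (HasTop-[] _)
-- A degree bound of 0 still allows trailing zeros, so the tail is only `≋` to the empty list.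
HasTop-* {a ∷ p} {q} {zero} hp hq = HasTop-≋
  (≋-trans (+ₚ-cong ≋-refl (≋-trans (∷-cong refl (*ₚ-cong {p} p≋[] (≋-refl {q}))) 0∷[])) (+ₚ-identityʳ _))
  (HasTop-≡ refl (cong (ℚ._* _) (hp .top)) (HasTop-·ₚ a hq))
  where
  p≋[] : p ≋ []
  p≋[] .at m = hp .above (ℕ.s≤s ℕ.z≤n)
HasTop-* {a ∷ p} {q} {suc d} hp hq = HasTop-≡ refl
  (trans (cong (ℚ._+ _) (ℚₚ.*-zeroʳ a)) (ℚₚ.+-identityˡ _))
  (HasTop-+ (HasTop-·ₚ a (HasTop-raiseBy d hq))
    (HasTop-0∷ (HasTop-* {p} {d = d} (record { above = hp .above ∘ ℕ.s<s ; top = hp .top }) hq)))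

HasTop-const : ∀ c → HasTop (constₚ c) 0 c
HasTop-const c .above {suc m} _ = refl
HasTop-const c .top             = refl

HasTop-∑ : ∀ n {f : Fin n → Poly} {g : Fin n → ℚ} {d} → (∀ i → HasTop (f i) d (g i)) → HasTop (P.∑ f) d (Q.∑ g)
HasTop-∑ zero    h = HasTop-≋ (P.∑-zero _) (HasTop-≡ refl (sym (Q.∑-zero _)) (HasTop-[] _))
HasTop-∑ (suc n) h = HasTop-≋ (P.∑-suc _) (HasTop-≡ refl (sym (Q.∑-suc _))
  (HasTop-+ (h zero) (HasTop-∑ n (h ∘ suc))))

HasTop-sgn : ∀ k → HasTop (P.sgn k) 0 (Q.sgn k)
HasTop-sgn zero    = HasTop-const 1ℚ
HasTop-sgn (suc k) = HasTop-≡ refl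
  (trans (sym (ℚₚ.neg-distribˡ-* 1ℚ (Q.sgn k))) (cong -_ (ℚₚ.*-identityˡ (Q.sgn k))))
  (HasTop-·ₚ (- 1ℚ) (HasTop-sgn k))

open import Algebra.Properties.CommutativeMonoid.Sum ℕₚ.+-0-commutativeMonoid
  using (sum; sum-remove; ∑-distrib-+)
open import Algebra.Properties.CommutativeSemigroup ℕₚ.+-commutativeSemigroup using (interchange)

-- Each term of the determinant uses every row and every column once, so the bounds r i + c j add up
-- to the same total in all terms, and the top coefficients combine to the determinant of the tops.
HasTop-det : ∀ n {M : P.Matrix n n} {t : Q.Matrix n n} (r c : Fin n → ℕ) →
  (∀ i j → HasTop (M i j) (r i ℕ.+ c j) (t i j)) → HasTop (P.det n M) (sum r ℕ.+ sum c) (Q.det n t)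
HasTop-det zero    r c h = HasTop-≋ (P.det-zero _) (HasTop-≡ refl (sym (Q.det-zero _)) (HasTop-const 1ℚ))
HasTop-det (suc n) r c h = HasTop-≋ (P.det-suc n _) (HasTop-≡ refl (sym (Q.det-suc n _))
  (HasTop-∑ (suc n) λ j → HasTop-≡ (degree j) refl
    (HasTop-* (HasTop-sgn (toℕ j)) (HasTop-* (h zero j)
      (HasTop-det n (r ∘ suc) (c ∘ punchIn j) λ i k → h (suc i) (punchIn j k))))))
  where
  degree : ∀ j → r zero ℕ.+ c j ℕ.+ (sum (r ∘ suc) ℕ.+ sum (c ∘ punchIn j)) ≡ sum r ℕ.+ sum c
  degree j = trans (interchange (r zero) (c j) (sum (r ∘ suc)) (sum (c ∘ punchIn j)))
    (cong (sum r ℕ.+_) (sym (sum-remove {i = j} c)))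

-- Bernoulli numbers

-- Defs keeps the fuel-indexed recursion behind bernoulliNum local, so it is
-- recovered by unification: first its instances (1+m, m, j), where the leading
-- argument is the index of the enclosing call, then, abstracting 1+m, the
-- function itself.
mutual
  bernoulliTail : ℕ → ℕ → ℚ
  bernoulliTail = _

  bernoulliNum-tail : ∀ m → bernoulliNum (suc m) ≡
    - ((+ 1 ℚ./ suc (suc m)) ℚ.* sumℚ (suc m) (λ j → fromℕℚ (suc (suc m) C j) ℚ.* bernoulliTail m j))
  bernoulliNum-tail m = refl

mutual
  bernoulliGo : ℕ → ℕ → ℕ → ℚ
  bernoulliGo = _

  bernoulliTail≡bernoulliGo : ∀ m j → bernoulliTail m j ≡ bernoulliGo (suc m) m j
  bernoulliTail≡bernoulliGo m j with suc m
  ... | k = refl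

sumℚ-cong : ∀ n {f g} → (∀ j → j ℕ.< n → f j ≡ g j) → sumℚ n f ≡ sumℚ n g
sumℚ-cong zero    f≡g = refl
sumℚ-cong (suc n) f≡g = cong₂ ℚ._+_ (sumℚ-cong n λ j j<n → f≡g j (ℕₚ.m<n⇒m<1+n j<n)) (f≡g n (ℕₚ.n<1+n n))

-- The summands of `bernoulliNum (suc m)` all run with fuel `m`, whereas `bernoulliNum j` runs with
-- fuel `j`; any fuel that reaches the index gives the same value.
bernoulliGo-fuel : ∀ k l f g m → m ℕ.≤ f → m ℕ.≤ g → bernoulliGo k f m ≡ bernoulliGo l g m
bernoulliGo-fuel k l f       g       zero    _ _ = refl
bernoulliGo-fuel k l (suc f) (suc g) (suc m) (ℕ.s≤s m≤f) (ℕ.s≤s m≤g) =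
  cong (λ x → - ((+ 1 ℚ./ suc (suc m)) ℚ.* x)) (sumℚ-cong (suc m) λ j j<1+m →
    cong (fromℕℚ (suc (suc m) C j) ℚ.*_) (bernoulliGo-fuel k l f g j
      (ℕₚ.≤-trans (ℕ.s≤s⁻¹ j<1+m) m≤f) (ℕₚ.≤-trans (ℕ.s≤s⁻¹ j<1+m) m≤g)))

bernoulliNum-suc : ∀ m → bernoulliNum (suc m) ≡
  - ((+ 1 ℚ./ suc (suc m)) ℚ.* sumℚ (suc m) (λ j → fromℕℚ (suc (suc m) C j) ℚ.* bernoulliNum j))
bernoulliNum-suc m = cong (λ x → - ((+ 1 ℚ./ suc (suc m)) ℚ.* x)) (sumℚ-cong (suc m) λ j j<1+m →
  cong (fromℕℚ (suc (suc m) C j) ℚ.*_) (bernoulliGo-fuel (suc m) j m j j (ℕ.s≤s⁻¹ j<1+m) ℕₚ.≤-refl))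

toℚᵘ-/ : ∀ i n .{{_ : NonZero n}} → ℚ.toℚᵘ (i ℚ./ n) ℚᵘ.≃ i ℚᵘ./ n
toℚᵘ-/ i (suc n) = ℚₚ.toℚᵘ-fromℚᵘ (i ℚᵘ./ suc n)

fromℕℚ-suc : ∀ n → fromℕℚ (suc n) ≡ 1ℚ ℚ.+ fromℕℚ n
fromℕℚ-suc n = ℚₚ.toℚᵘ-injective (begin
  ℚ.toℚᵘ (fromℕℚ (suc n))           ≈⟨ toℚᵘ-/ (+ suc n) 1 ⟩
  + suc n ℚᵘ./ 1                    ≈⟨ ℚᵘ.*≡* (cong (λ x → (+ 1 ℤ.+ x) ℤ.* + 1) (sym (ℤₚ.*-identityʳ (+ n)))) ⟩
  ℚᵘ.1ℚᵘ ℚᵘ.+ + n ℚᵘ./ 1            ≈⟨ ℚᵘₚ.+-congʳ ℚᵘ.1ℚᵘ (toℚᵘ-/ (+ n) 1) ⟨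
  ℚ.toℚᵘ 1ℚ ℚᵘ.+ ℚ.toℚᵘ (fromℕℚ n)  ≈⟨ ℚₚ.toℚᵘ-homo-+ 1ℚ (fromℕℚ n) ⟨
  ℚ.toℚᵘ (1ℚ ℚ.+ fromℕℚ n)          ∎)
  where open ℚᵘₚ.≃-Reasoning

/-*-cancel : ∀ i n .{{_ : NonZero n}} → (+ i ℚ./ n) ℚ.* fromℕℚ n ≡ fromℕℚ i
/-*-cancel i n@(suc _) = ℚₚ.toℚᵘ-injective (begin
  ℚ.toℚᵘ ((+ i ℚ./ n) ℚ.* fromℕℚ n)            ≈⟨ ℚₚ.toℚᵘ-homo-* (+ i ℚ./ n) (fromℕℚ n) ⟩
  ℚ.toℚᵘ (+ i ℚ./ n) ℚᵘ.* ℚ.toℚᵘ (fromℕℚ n)    ≈⟨ ℚᵘₚ.*-cong (toℚᵘ-/ (+ i) n) (toℚᵘ-/ (+ n) 1) ⟩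
  (+ i ℚᵘ./ n) ℚᵘ.* (+ n ℚᵘ./ 1)               ≈⟨ ℚᵘ.*≡* (trans (ℤₚ.*-identityʳ (+ i ℤ.* + n)) (cong (λ k → + i ℤ.* + k) (sym (ℕₚ.*-identityʳ n)))) ⟩
  + i ℚᵘ./ 1                                   ≈⟨ toℚᵘ-/ (+ i) 1 ⟨
  ℚ.toℚᵘ (fromℕℚ i)                            ∎)
  where open ℚᵘₚ.≃-Reasoning

module QS = Sequences ℚₚ.+-*-commutativeRing
module QH = HankelEvaluation ℚₚ.+-*-commutativeRing
open import Algebra.Properties.Semiring.Mult (CommutativeRing.semiring ℚₚ.+-*-commutativeRing)
  using (×1-homo-*) renaming (_×_ to _·ℚ_; ×-congʳ to ·ℚ-congʳ)
open import Algebra.Properties.Semiring.Exp (CommutativeRing.semiring ℚₚ.+-*-commutativeRing)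
  using () renaming (_^_ to _^ℚ_)
open import Algebra.Properties.Semiring.Mult (CommutativeRing.semiring polyRing)
  using () renaming (_×_ to _·P_)
open import Algebra.Properties.Semiring.Exp (CommutativeRing.semiring polyRing)
  using () renaming (_^_ to _^P_)

·ℚ≡fromℕℚ : ∀ n x → n ·ℚ x ≡ fromℕℚ n ℚ.* x
·ℚ≡fromℕℚ zero    x = sym (ℚₚ.*-zeroˡ x)
·ℚ≡fromℕℚ (suc n) x = trans (cong (x ℚ.+_) (·ℚ≡fromℕℚ n x)) (trans
  (solve 2 (λ x y → x :+ y :* x := (con 1ℚ :+ y) :* x) refl x (fromℕℚ n))
  (cong (ℚ._* x) (sym (fromℕℚ-suc n))))

ι≡fromℕℚ : ∀ n → QH.ι n ≡ fromℕℚ n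
ι≡fromℕℚ n = trans (·ℚ≡fromℕℚ n 1ℚ) (ℚₚ.*-identityʳ (fromℕℚ n))

1^ℚ : ∀ n → 1ℚ ^ℚ n ≡ 1ℚ
1^ℚ zero    = refl
1^ℚ (suc n) = trans (ℚₚ.*-identityˡ (1ℚ ^ℚ n)) (1^ℚ n)

reciprocal : ℕ → ℚ
reciprocal n = + 1 ℚ./ suc n

isReciprocal : QH.IsReciprocal reciprocal
isReciprocal n = trans (cong (ℚ._* reciprocal n) (ι≡fromℕℚ (suc n))) (trans
  (ℚₚ.*-comm (fromℕℚ (suc n)) (reciprocal n)) (/-*-cancel 1 (suc n)))

sumℚ≡∑ : ∀ n f → Q.∑ {n} (f ∘ toℕ) ≡ sumℚ n f
sumℚ≡∑ zero    f = Q.∑-zero (f ∘ toℕ)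
sumℚ≡∑ (suc n) f = trans (Q.∑-last n f) (cong (ℚ._+ f n) (sumℚ≡∑ n f))

[1+n]Cn≡1+n : ∀ n → suc n C n ≡ suc n
[1+n]Cn≡1+n n = trans (nCk≡nC[n∸k] (ℕₚ.n≤1+n n)) (trans
  (cong (suc n C_) (ℕₚ.m+n∸n≡m 1 n)) (nC1≡n (suc n)))

bernoulli-sum : ∀ m →
  sumℚ (2 ℕ.+ m) (λ j → fromℕℚ ((2 ℕ.+ m) C j) ℚ.* bernoulliNum j) ≡ 0ℚ
bernoulli-sum m = begin
  S ℚ.+ fromℕℚ ((2 ℕ.+ m) C suc m) ℚ.* bernoulliNum (suc m)
    ≡⟨ cong₂ (λ k x → S ℚ.+ fromℕℚ k ℚ.* x) ([1+n]Cn≡1+n (suc m)) (bernoulliNum-suc m) ⟩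
  S ℚ.+ c ℚ.* (- (r ℚ.* S))
    ≡⟨ cong (S ℚ.+_) (trans (sym (ℚₚ.neg-distribʳ-* c (r ℚ.* S))) (cong -_
         (solve 3 (λ c r s → c :* (r :* s) := (r :* c) :* s) refl c r S))) ⟩
  S ℚ.+ - ((r ℚ.* c) ℚ.* S)
    ≡⟨ cong (λ x → S ℚ.+ - x) (trans (cong (ℚ._* S) (/-*-cancel 1 (2 ℕ.+ m))) (ℚₚ.*-identityˡ S)) ⟩
  S ℚ.+ - S
    ≡⟨ ℚₚ.+-inverseʳ S ⟩
  0ℚ ∎
  where
  open ≡.≡-Reasoning
  S c r : ℚ
  S = sumℚ (suc m) (λ j → fromℕℚ ((2 ℕ.+ m) C j) ℚ.* bernoulliNum j)
  c = fromℕℚ (2 ℕ.+ m)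
  r = + 1 ℚ./ (2 ℕ.+ m)

-- The identity B_k(1) = B_k(0) + [k = 1]. From k = 2 on the sum without its last term vanishes by
-- the recursion; the correction at k = 1 reflects B_1 = -1/2.
bernoulli-binomial : ∀ k →
  sumℚ (suc k) (λ j → fromℕℚ (k C j) ℚ.* bernoulliNum j) ≡ bernoulliNum k ℚ.+ QH.δ′ k
bernoulli-binomial zero          = refl
bernoulli-binomial (suc zero)    = refl
bernoulli-binomial (suc (suc m)) = begin
  sumℚ (2 ℕ.+ m) f ℚ.+ fromℕℚ ((2 ℕ.+ m) C (2 ℕ.+ m)) ℚ.* bernoulliNum (2 ℕ.+ m)
    ≡⟨ cong₂ ℚ._+_ (bernoulli-sum m) (cong (λ k → fromℕℚ k ℚ.* bernoulliNum (2 ℕ.+ m)) (nCn≡1 (2 ℕ.+ m))) ⟩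
  0ℚ ℚ.+ 1ℚ ℚ.* bernoulliNum (2 ℕ.+ m)
    ≡⟨ solve 1 (λ b → con 0ℚ :+ con 1ℚ :* b := b :+ con 0ℚ) refl (bernoulliNum (2 ℕ.+ m)) ⟩
  bernoulliNum (2 ℕ.+ m) ℚ.+ 0ℚ ∎
  where
  open ≡.≡-Reasoning
  f : ℕ → ℚ
  f j = fromℕℚ ((2 ℕ.+ m) C j) ℚ.* bernoulliNum j

isBernoulli : QH.IsBernoulli bernoulliNum
isBernoulli k = begin
  QS.orbit (QS.⊹-linear QS.shift-linear 1ℚ) bernoulliNum k
    ≡⟨ QH.newton-1⊹shift {v = λ _ → 0ℚ} {w = λ _ → 1ℚ} (λ _ → refl) k bernoulliNum 0 ⟨
  QS.newton QS.shift (λ _ → 1ℚ) k bernoulliNum 0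
    ≡⟨ QS.newton-expand (λ _ → 1ℚ) k bernoulliNum 0 ⟩
  Q.∑ {suc k} (λ j → QS.coefficient (λ _ → 1ℚ) k (toℕ j) ℚ.* bernoulliNum (toℕ j ℕ.+ 0))
    ≡⟨ Q.∑-cong {suc k} (λ j → cong₂ ℚ._*_ (binomial (toℕ j)) (cong bernoulliNum (ℕₚ.+-identityʳ (toℕ j)))) ⟩
  Q.∑ {suc k} ((λ j → fromℕℚ (k C j) ℚ.* bernoulliNum j) ∘ toℕ)
    ≡⟨ sumℚ≡∑ (suc k) _ ⟩
  sumℚ (suc k) (λ j → fromℕℚ (k C j) ℚ.* bernoulliNum j)
    ≡⟨ bernoulli-binomial k ⟩
  bernoulliNum k ℚ.+ QH.δ′ k ∎
  where
  open ≡.≡-Reasoning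
  binomial : ∀ j → QS.coefficient (λ _ → 1ℚ) k j ≡ fromℕℚ (k C j)
  binomial j = trans (QS.coefficient-binomial 1ℚ k j) (trans (·ℚ-congʳ (k C j) (1^ℚ (k ℕ.∸ j))) (ι≡fromℕℚ (k C j)))

-- Closed form of the Bernoulli determinant

Q-sgn≡signℚ : ∀ k → Q.sgn k ≡ signℚ k
Q-sgn≡signℚ zero    = refl
Q-sgn≡signℚ (suc k) = cong -_ (Q-sgn≡signℚ k)

signℚ-+ : ∀ a b → signℚ (a ℕ.+ b) ≡ signℚ a ℚ.* signℚ b
signℚ-+ zero    b = sym (ℚₚ.*-identityˡ (signℚ b))
signℚ-+ (suc a) b = trans (cong -_ (signℚ-+ a b)) (ℚₚ.neg-distribˡ-* (signℚ a) (signℚ b))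

fromℕℚ-cancel : ∀ n .{{_ : NonZero n}} {x y} → fromℕℚ n ℚ.* x ≡ fromℕℚ n ℚ.* y → x ≡ y
fromℕℚ-cancel n {x} {y} nx≡ny = trans (sym (reduce x)) (trans (cong (+ 1 ℚ./ n ℚ.*_) nx≡ny) (reduce y))
  where
  reduce : ∀ z → (+ 1 ℚ./ n) ℚ.* (fromℕℚ n ℚ.* z) ≡ z
  reduce z = trans (sym (ℚₚ.*-assoc (+ 1 ℚ./ n) (fromℕℚ n) z))
    (trans (cong (ℚ._* z) (/-*-cancel 1 n)) (ℚₚ.*-identityˡ z))

factor : ℕ → ℚ
factor k = (QH.ι (k !) ℚ.* (Q.sgn k ℚ.* QH.ι (k !))) ℚ.* QH.hilbertFactor reciprocal 0 k

denominator : ℕ → ℕ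
denominator j = (2 * j) ! * (suc (2 * j)) !

-- Of the six factorials, two come from scaling row and column k, and four from the Hilbert pivot
-- with b = 0.
factor≡ : ∀ k → factor k ≡ signℚ k ℚ.* prodFactor k
factor≡ k = begin
  factor k
    ≡⟨ solve 3 (λ f s h → (f :* (s :* f)) :* h := s :* ((f :* f) :* h)) refl f (Q.sgn k) h ⟩
  Q.sgn k ℚ.* ((f ℚ.* f) ℚ.* h)
    ≡⟨ cong₂ ℚ._*_ (Q-sgn≡signℚ k) (fromℕℚ-cancel (denominator k) {{(2 * k) ℕₚ.!* (suc (2 * k)) !≢0}} cancelled) ⟩
  signℚ k ℚ.* prodFactor k ∎
  where
  open ≡.≡-Reasoning
  f h : ℚ
  f = QH.ι (k !)
  h = QH.hilbertFactor reciprocal 0 k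
  cancelled : fromℕℚ (denominator k) ℚ.* ((f ℚ.* f) ℚ.* h) ≡ fromℕℚ (denominator k) ℚ.* prodFactor k
  cancelled = begin
    fromℕℚ (denominator k) ℚ.* ((f ℚ.* f) ℚ.* h)
      ≡⟨ cong (ℚ._* ((f ℚ.* f) ℚ.* h)) (ι≡fromℕℚ (denominator k)) ⟨
    QH.ι (denominator k) ℚ.* ((f ℚ.* f) ℚ.* h)
      ≡⟨ solve 3 (λ d f h → d :* (f :* h) := f :* (d :* h)) refl (QH.ι (denominator k)) (f ℚ.* f) h ⟩
    (f ℚ.* f) ℚ.* (QH.ι (denominator k) ℚ.* h)
      ≡⟨ cong₂ ℚ._*_ (sym (×1-homo-* (k !) (k !))) (QH.ι-hilbertFactor isReciprocal 0 k) ⟩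
    QH.ι (k ! * k !) ℚ.* QH.ι ((k ! * k !) * (k ! * k !))
      ≡⟨ ×1-homo-* (k ! * k !) ((k ! * k !) * (k ! * k !)) ⟨
    QH.ι ((k ! * k !) * ((k ! * k !) * (k ! * k !)))
      ≡⟨ cong QH.ι (sixth (k !)) ⟩
    QH.ι ((k !) ℕ.^ 6)
      ≡⟨ ι≡fromℕℚ ((k !) ℕ.^ 6) ⟩
    fromℕℚ ((k !) ℕ.^ 6)
      ≡⟨ /-*-cancel ((k !) ℕ.^ 6) (denominator k) {{(2 * k) ℕₚ.!* (suc (2 * k)) !≢0}} ⟨
    prodFactor k ℚ.* fromℕℚ (denominator k)
      ≡⟨ ℚₚ.*-comm (prodFactor k) (fromℕℚ (denominator k)) ⟩
    fromℕℚ (denominator k) ℚ.* prodFactor k ∎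
    where
    sixth : ∀ x → (x * x) * ((x * x) * (x * x)) ≡ x ℕ.^ 6
    sixth = ℕ-solve 1 (λ x → (x ⊗ x) ⊗ ((x ⊗ x) ⊗ (x ⊗ x)) ⊜ x ⊗ (x ⊗ (x ⊗ (x ⊗ (x ⊗ (x ⊗ ℕ-con 1)))))) refl

∏-factor : ∀ n → Q.∏ {suc n} (factor ∘ toℕ) ≡ leadingValue n
∏-factor zero    = trans (Q.∏-last 0 factor) (trans
  (cong (ℚ._* factor 0) (Q.∏-zero _)) (trans (ℚₚ.*-identityˡ (factor 0)) (factor≡ 0)))
∏-factor (suc n) = begin
  Q.∏ {2 ℕ.+ n} (factor ∘ toℕ)
    ≡⟨ Q.∏-last (suc n) factor ⟩
  Q.∏ {suc n} (factor ∘ toℕ) ℚ.* factor (suc n)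
    ≡⟨ cong₂ ℚ._*_ (∏-factor n) (factor≡ (suc n)) ⟩
  (signℚ (suc n C 2) ℚ.* prodℚ n) ℚ.* (signℚ (suc n) ℚ.* prodFactor (suc n))
    ≡⟨ solve 4 (λ s p t f → (s :* p) :* (t :* f) := (t :* s) :* (p :* f)) refl
         (signℚ (suc n C 2)) (prodℚ n) (signℚ (suc n)) (prodFactor (suc n)) ⟩
  (signℚ (suc n) ℚ.* signℚ (suc n C 2)) ℚ.* prodℚ (suc n)
    -- The signs accumulate to the exponent 0 + 1 + ... + (n+1), which Pascal's rule identifies with
    -- the binomial coefficient.
    ≡⟨ cong (ℚ._* prodℚ (suc n)) (trans (sym (signℚ-+ (suc n) (suc n C 2))) (cong signℚ
         (trans (cong (ℕ._+ suc n C 2) (sym (nC1≡n (suc n)))) (nCk+nC[k+1]≡[n+1]C[k+1] (suc n) 1)))) ⟩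
  leadingValue (suc n) ∎
  where open ≡.≡-Reasoning

det-bernoulliNum : ∀ n → Q.det (suc n) (λ i j → bernoulliNum (toℕ i ℕ.+ toℕ j)) ≡ leadingValue n
det-bernoulliNum n = trans (QH.det-bernoulli isBernoulli isReciprocal (suc n)) (∏-factor n)

-- Nonvanishing of the leading value

Invertible : ℚ → Set
Invertible x = ∃ λ y → x ℚ.* y ≡ 1ℚ

invertible-* : ∀ x y → Invertible x → Invertible y → Invertible (x ℚ.* y)
invertible-* x y (x⁻¹ , xx⁻¹) (y⁻¹ , yy⁻¹) = x⁻¹ ℚ.* y⁻¹ , trans
  (solve 4 (λ x y a b → (x :* y) :* (a :* b) := (x :* a) :* (y :* b)) refl x y x⁻¹ y⁻¹)
  (trans (cong₂ ℚ._*_ xx⁻¹ yy⁻¹) (ℚₚ.*-identityˡ 1ℚ))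

invertible⇒≢0 : ∀ {x} → Invertible x → x ≢ 0ℚ
invertible⇒≢0 (y , xy≡1) refl = ℚₚ.1≢0 (trans (sym xy≡1) (ℚₚ.*-zeroˡ y))

signℚ-invertible : ∀ k → Invertible (signℚ k)
signℚ-invertible zero    = 1ℚ , refl
signℚ-invertible (suc k) with signℚ-invertible k
... | y , sy≡1 = - y , trans (solve 2 (λ s y → (:- s) :* (:- y) := s :* y) refl (signℚ k) y) sy≡1

prodFactor-invertible : ∀ k → Invertible (prodFactor k)
prodFactor-invertible k = fromℕℚ D ℚ.* (+ 1 ℚ./ N) , (begin
  prodFactor k ℚ.* (fromℕℚ D ℚ.* (+ 1 ℚ./ N))
    ≡⟨ ℚₚ.*-assoc (prodFactor k) (fromℕℚ D) (+ 1 ℚ./ N) ⟨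
  (prodFactor k ℚ.* fromℕℚ D) ℚ.* (+ 1 ℚ./ N)
    ≡⟨ cong (ℚ._* (+ 1 ℚ./ N)) (/-*-cancel N D {{(2 * k) ℕₚ.!* (suc (2 * k)) !≢0}}) ⟩
  fromℕℚ N ℚ.* (+ 1 ℚ./ N)
    ≡⟨ trans (ℚₚ.*-comm (fromℕℚ N) (+ 1 ℚ./ N)) (/-*-cancel 1 N) ⟩
  1ℚ ∎)
  where
  open ≡.≡-Reasoning
  N D : ℕ
  N = (k !) ℕ.^ 6
  D = denominator k
  instance
    N≢0 : NonZero N
    N≢0 = ℕₚ.m^n≢0 (k !) 6 {{k ℕₚ.!≢0}}

-- Explicit inverses are carried along instead of inequalities, as they multiply by a ring identity.
leadingValue≢0 : ∀ n → leadingValue n ≢ 0ℚ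
leadingValue≢0 n = invertible⇒≢0 {leadingValue n} (invertible-* (signℚ (suc n C 2)) (prodℚ n) (signℚ-invertible (suc n C 2)) (prodℚ-invertible n))
  where
  prodℚ-invertible : ∀ n → Invertible (prodℚ n)
  prodℚ-invertible zero    = 1ℚ , refl
  prodℚ-invertible (suc n) = invertible-* (prodℚ n) (prodFactor (suc n)) (prodℚ-invertible n) (prodFactor-invertible (suc n))

-- Bernoulli polynomials and list determinants in the polynomial ring

sumₚ≋∑ : ∀ n f → sumₚ n f ≋ P.∑ {n} (f ∘ toℕ)
sumₚ≋∑ zero    f = ≋-sym (P.∑-zero _)
sumₚ≋∑ (suc n) f = ≋-trans (+ₚ-cong (sumₚ≋∑ n f) ≋-refl) (≋-sym (P.∑-last n f))

sumFinₚ≋∑ : ∀ n f → sumFinₚ n f ≋ P.∑ f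
sumFinₚ≋∑ zero    f = ≋-sym (P.∑-zero _)
sumFinₚ≋∑ (suc n) f = ≋-trans (+ₚ-cong ≋-refl (sumFinₚ≋∑ n (f ∘ suc))) (≋-sym (P.∑-suc _))

sgn≋signℚ : ∀ k → P.sgn k ≋ constₚ (signℚ k)
sgn≋signℚ zero    = ≋-refl
sgn≋signℚ (suc k) = ≋-trans (·ₚ-cong (- 1ℚ) (sgn≋signℚ k)) (∷-cong
  (trans (sym (ℚₚ.neg-distribˡ-* 1ℚ (signℚ k))) (cong -_ (ℚₚ.*-identityˡ (signℚ k)))) ≋-refl)

det≋ : ∀ n {M N : P.Matrix n n} → (∀ i j → M i j ≋ N i j) → det n M ≋ P.det n N
det≋ zero    M≋N = ≋-sym (P.det-zero _)
det≋ (suc n) {M} {N} M≋N = ≋-trans (sumFinₚ≋∑ (suc n) _) (≋-trans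
  (P.∑-cong λ j → ≋-trans (≋-sym (constₚ-*ₚ (signℚ (toℕ j)) _))
    (*ₚ-cong (≋-sym (sgn≋signℚ (toℕ j))) (*ₚ-cong (M≋N zero j)
      (det≋ n λ r c → M≋N (suc r) (punchIn j c)))))
  (≋-sym (P.det-suc n N)))

·P≋·ₚ : ∀ n p → n ·P p ≋ fromℕℚ n ·ₚ p
·P≋·ₚ zero    p = ≋-sym (0·ₚ p)
·P≋·ₚ (suc n) p = ≋-trans (+ₚ-cong ≋-refl (·P≋·ₚ n p)) (pointwise λ m → begin
  coeff (p +ₚ fromℕℚ n ·ₚ p) m
    ≡⟨ trans (coeff-+ₚ p (fromℕℚ n ·ₚ p) m) (cong (coeff p m ℚ.+_) (coeff-·ₚ (fromℕℚ n) p m)) ⟩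
  coeff p m ℚ.+ fromℕℚ n ℚ.* coeff p m
    ≡⟨ solve 2 (λ x y → x :+ y :* x := (con 1ℚ :+ y) :* x) refl (coeff p m) (fromℕℚ n) ⟩
  (1ℚ ℚ.+ fromℕℚ n) ℚ.* coeff p m
    ≡⟨ trans (coeff-·ₚ (fromℕℚ (suc n)) p m) (cong (ℚ._* coeff p m) (fromℕℚ-suc n)) ⟨
  coeff (fromℕℚ (suc n) ·ₚ p) m ∎)
  where open ≡.≡-Reasoning

^P≡^ₚ : ∀ p n → p ^P n ≡ p ^ₚ n
^P≡^ₚ p zero    = refl
^P≡^ₚ p (suc n) = cong (p *ₚ_) (^P≡^ₚ p n)

·ₚ-·ₚ : ∀ a b p → (a ℚ.* b) ·ₚ p ≋ a ·ₚ (b ·ₚ p)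
·ₚ-·ₚ a b p .at m = begin
  coeff ((a ℚ.* b) ·ₚ p) m   ≡⟨ coeff-·ₚ (a ℚ.* b) p m ⟩
  a ℚ.* b ℚ.* coeff p m      ≡⟨ ℚₚ.*-assoc a b (coeff p m) ⟩
  a ℚ.* (b ℚ.* coeff p m)    ≡⟨ cong (a ℚ.*_) (coeff-·ₚ b p m) ⟨
  a ℚ.* coeff (b ·ₚ p) m     ≡⟨ coeff-·ₚ a (b ·ₚ p) m ⟨
  coeff (a ·ₚ (b ·ₚ p)) m    ∎
  where open ≡.≡-Reasoning

bernoulliConst : P.Seq
bernoulliConst j = constₚ (bernoulliNum j)

-- The umbral formula B_k(q) = L[(q + z)ᵏ]: expanding the power by the binomial theorem gives the
-- defining sum.
bernoulliAt≋newton : ∀ k q → bernoulliAt k q ≋ P.newton P.shift (λ _ → q) k bernoulliConst 0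
bernoulliAt≋newton k q = ≋-trans (sumₚ≋∑ (suc k) _) (≋-trans
  (P.∑-cong {suc k} λ j → term (toℕ j))
  (≋-sym (P.newton-expand (λ _ → q) k bernoulliConst 0)))
  where
  open ≋-Reasoning
  term : ∀ j → (fromℕℚ (k C j) ℚ.* bernoulliNum j) ·ₚ (q ^ₚ (k ℕ.∸ j)) ≋
    P.coefficient (λ _ → q) k j *ₚ bernoulliConst (j ℕ.+ 0)
  term j = begin
    (fromℕℚ (k C j) ℚ.* bernoulliNum j) ·ₚ p
      ≡⟨ cong (_·ₚ p) (ℚₚ.*-comm (fromℕℚ (k C j)) (bernoulliNum j)) ⟩
    (bernoulliNum j ℚ.* fromℕℚ (k C j)) ·ₚ p
      ≈⟨ ·ₚ-·ₚ (bernoulliNum j) (fromℕℚ (k C j)) p ⟩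
    bernoulliNum j ·ₚ (fromℕℚ (k C j) ·ₚ p)
      ≈⟨ constₚ-*ₚ (bernoulliNum j) _ ⟨
    bernoulliConst j *ₚ (fromℕℚ (k C j) ·ₚ p)
      ≈⟨ *ₚ-congˡ (bernoulliConst j) (·P≋·ₚ (k C j) p) ⟨
    bernoulliConst j *ₚ ((k C j) ·P p)
      ≡⟨ cong (λ x → bernoulliConst j *ₚ ((k C j) ·P x)) (^P≡^ₚ q (k ℕ.∸ j)) ⟨
    bernoulliConst j *ₚ ((k C j) ·P (q ^P (k ℕ.∸ j)))
      ≈⟨ *ₚ-congˡ (bernoulliConst j) (P.coefficient-binomial q k j) ⟨
    bernoulliConst j *ₚ P.coefficient (λ _ → q) k j
      ≈⟨ *ₚ-comm (bernoulliConst j) _ ⟩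
    P.coefficient (λ _ → q) k j *ₚ bernoulliConst j
      ≡⟨ cong (λ i → P.coefficient (λ _ → q) k j *ₚ bernoulliConst i) (ℕₚ.+-identityʳ j) ⟨
    P.coefficient (λ _ → q) k j *ₚ bernoulliConst (j ℕ.+ 0) ∎
    where
    p : Poly
    p = q ^ₚ (k ℕ.∸ j)

-- Degree and leading coefficient of the Hankel determinant

reduced : P.Seq
reduced = P.orbit (P.quadratic-linear halfOnePlusX) bernoulliConst

hankel≋ : ∀ n → hankel n bernoulliSeq ≋ P.det (suc n) (λ i j → reduced (toℕ i ℕ.+ toℕ j))
hankel≋ n = ≋-trans
  (det≋ (suc n) λ i j → bernoulliAt≋newton (2 * (toℕ i ℕ.+ toℕ j)) halfOnePlusX)
  (P.det-even (suc n) halfOnePlusX bernoulliConst)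

HasTop-reduced : ∀ k → HasTop (reduced k) k (bernoulliNum k)
HasTop-reduced k = HasTop-≡ refl (cong bernoulliNum (ℕₚ.+-identityʳ k)) (go k 0)
  where
  y : Poly
  y = halfOnePlusX
  HasTop-2y : HasTop (y +ₚ y) 1 1ℚ
  HasTop-2y .above {suc (suc m)} _            = refl
  HasTop-2y .above {suc zero} (ℕ.s≤s ())
  HasTop-2y .top                              = refl
  -- All `m` are needed, since one application of `quadratic` reads the positions m+1 and m+2. The
  -- first comes with 2y = 1 + x, which raises the degree by one with top coefficient 1; the second
  -- has too small a degree to contribute to the top.
  go : ∀ k m → HasTop (P.newton (P.quadratic y) (λ _ → []) k bernoulliConst m) k (bernoulliNum (k ℕ.+ m))
  go zero    m = HasTop-const _
  go (suc k) m = HasTop-≡ refl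
    (trans (ℚₚ.+-identityʳ _) (trans (ℚₚ.*-identityˡ _) (cong bernoulliNum (ℕₚ.+-suc k m))))
    (HasTop-+ (HasTop-* HasTop-2y (go k (suc m))) (HasTop-raise (go k (2 ℕ.+ m))))

sum-toℕ : ∀ n → sum {suc n} toℕ ℕ.+ sum {suc n} toℕ ≡ n * suc n
sum-toℕ zero    = refl
sum-toℕ (suc n) = begin
  sum {suc n} (suc ∘ toℕ) ℕ.+ sum {suc n} (suc ∘ toℕ)
    ≡⟨ cong (λ s → s ℕ.+ s) (trans (∑-distrib-+ {suc n} (λ _ → 1) toℕ) (cong (ℕ._+ sum {suc n} toℕ) (sum-ones (suc n)))) ⟩
  (suc n ℕ.+ sum {suc n} toℕ) ℕ.+ (suc n ℕ.+ sum {suc n} toℕ)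
    ≡⟨ interchange (suc n) (sum {suc n} toℕ) (suc n) (sum {suc n} toℕ) ⟩
  (suc n ℕ.+ suc n) ℕ.+ (sum {suc n} toℕ ℕ.+ sum {suc n} toℕ)
    ≡⟨ cong ((suc n ℕ.+ suc n) ℕ.+_) (sum-toℕ n) ⟩
  (suc n ℕ.+ suc n) ℕ.+ n * suc n
    ≡⟨ ℕ-solve 1 (λ n → let m = ℕ-con 1 ⊕ n in
         (m ⊕ m) ⊕ n ⊗ m ⊜ m ⊗ (ℕ-con 1 ⊕ m)) refl n ⟩
  suc n * suc (suc n) ∎
  where
  open ≡.≡-Reasoning
  sum-ones : ∀ n → sum {n} (λ _ → 1) ≡ n
  sum-ones zero    = refl
  sum-ones (suc n) = cong suc (sum-ones n)

HasTop-hankel : ∀ n → HasTop (hankel n bernoulliSeq) (n * suc n) (leadingValue n)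
HasTop-hankel n = HasTop-≋ (hankel≋ n) (HasTop-≡ (sum-toℕ n) (det-bernoulliNum n)
  (HasTop-det (suc n) toℕ toℕ λ i j → HasTop-reduced (toℕ i ℕ.+ toℕ j)))

theorem1p2 : (n : ℕ) →
    ((m : ℕ) → n * suc n < m → coeff (hankel n bernoulliSeq) m ≡ 0ℚ)
    × (coeff (hankel n bernoulliSeq) (n * suc n) ≡ leadingValue n)
    × (leadingValue n ≢ 0ℚ)
theorem1p2 n = (λ m → HasTop-hankel n .above) , HasTop-hankel n .top , leadingValue≢0 n
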